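{- $\mathrm{SC} \not\leq_{\mathrm{w}} \mathrm{LUA}_{\mathrm{slow}}$.
   Context: Prefix-free complexity: a prefix-free machine is a partial recursive $M$ from $\{0,1\}^*$ to $\{0,1\}^*$ with prefix-free domain; $U$ is universal if for each prefix-free machine $M$ there is $\rho$ with $U(\rho^\frown\tau)\simeq M(\tau)$ for all $\tau$. Fix a universal $U$ and let $K(\sigma)=\min\{|\tau| : U(\tau)=\sigma\}$. $\mathrm{SC}$ is the set of shift complex sequences: those $X\in\{0,1\}^{\mathbb{N}}$ for which there are $\delta\in(0,1)$ and $c\in\mathbb{N}$ with $K(\tau)\geq\delta|\tau|-c$ for every (contiguous, finite) substring $\tau$ of $X$. An order function is a computable (i.e. its values are uniformly computable reals), nondecreasing, unbounded function $\mathbb{N}\to\mathbb{R}$. An order function $q\colon\mathbb{N}\to(1,\infty)$ is slow-growing if $\sum_{n=0}^\infty q(n)^{ -1}=\infty$. A partial recursive $\psi\colon\subseteq\mathbb{N}\to\mathbb{N}$ is linearly universal if for every partial recursive $\theta\colon\subseteq\mathbb{N}\to\mathbb{N}$ there are $a,b\in\mathbb{N}$ with $\psi(ax+b)\simeq\theta(x)$ for all $x$. For $p\colon\mathbb{N}\to(1,\infty)$, $\mathrm{LUA}(p)$ is the set of $X\in\mathbb{N}^{\mathbb{N}}$ such that $X(n)<p(n)$ for all $n$ and, for some linearly universal partial recursive $\psi$, there is no $n\in\operatorname{dom}\psi$ with $X(n)=\psi(n)$. $\mathrm{LUA}_{\mathrm{slow}}=\bigcup\{\mathrm{LUA}(q)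 : q\colon\mathbb{N}\to(1,\infty)\text{ a slow-growing order function}\}$. For $P,Q\subseteq\mathbb{N}^{\mathbb{N}}$, $P\leq_{\mathrm{w}}Q$ means every $Y\in Q$ Turing-computes some $X\in P$. -}

module Defs where

open import Data.Digit using (Bit)
open import Data.Empty using (⊥)
open import Data.Fin using (Fin; toℕ)
open import Data.Integer using (+_; _⊖_)
open import Data.List using (List; []; _∷_; foldr; length; applyUpTo) renaming (_++_ to _⌢_)
open import Data.List.Relation.Binary.Prefix.Heterogeneous using (Prefix)
open import Data.Nat as ℕ using (ℕ; zero; suc)
import Data.Nat.Properties as ℕₚ
open import Data.Product using (Σ-syntax; ∃-syntax; _×_; _,_)
open import Data.Rational as ℚ using (ℚ; 0ℚ; 1ℚ)
import Data.Rational.Properties as ℚₚ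
open import Data.Unit using (⊤)
open import Data.Vec using (Vec; []; _∷_; lookup)
open import Data.Vec.Relation.Binary.Pointwise.Inductive using (Pointwise)
open import Function using (_⇔_; _∘_)
open import Level using (0ℓ)
open import Relation.Binary.PropositionalEquality
open import Relation.Nullary using (¬_; yes; no; contradiction)
open import Relation.Unary using (Pred)

-- μ-recursive programs, with one oracle symbol for each element of O.
data Code (O : Set) : ℕ → Set where
  zeroᶜ  : Code O 0
  sucᶜ   : Code O 1
  projᶜ  : ∀ {n} → Fin n → Code O n
  queryᶜ : O → Code O 1
  compᶜ  : ∀ {m n} → Code O m → Vec (Code O n) m → Code O n
  precᶜ  : ∀ {n} → Code O n → Code O (2 ℕ.+ n) → Code O (suc n)
  minᶜ   : ∀ {n} → Code O (suc n) → Code O n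

-- φ ⊢ e · xs ⇓ y : with oracles φ, the program e halts on xs with output y.
data _⊢_·_⇓_ {O : Set} (φ : O → ℕ → ℕ) : ∀ {n} → Code O n → Vec ℕ n → ℕ → Set where
  zero⇓  : φ ⊢ zeroᶜ · [] ⇓ 0
  suc⇓   : ∀ {x} → φ ⊢ sucᶜ · (x ∷ []) ⇓ suc x
  proj⇓  : ∀ {n} {xs : Vec ℕ n} (i : Fin n) → φ ⊢ projᶜ i · xs ⇓ lookup xs i
  query⇓ : ∀ {x} (o : O) → φ ⊢ queryᶜ o · (x ∷ []) ⇓ φ o x
  comp⇓  : ∀ {m n} {f : Code O m} {gs : Vec (Code O n) m} {xs : Vec ℕ n} {ys : Vec ℕ m} {z} →
           Pointwise (λ g y → φ ⊢ g · xs ⇓ y) gs ys → φ ⊢ f · ys ⇓ z →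
           φ ⊢ compᶜ f gs · xs ⇓ z
  prec0⇓ : ∀ {n} {f : Code O n} {g} {xs : Vec ℕ n} {y} →
           φ ⊢ f · xs ⇓ y →
           φ ⊢ precᶜ f g · (0 ∷ xs) ⇓ y
  precs⇓ : ∀ {n} {f : Code O n} {g} {xs : Vec ℕ n} {k y z} →
           φ ⊢ precᶜ f g · (k ∷ xs) ⇓ y → φ ⊢ g · (k ∷ y ∷ xs) ⇓ z →
           φ ⊢ precᶜ f g · (suc k ∷ xs) ⇓ z
  min⇓   : ∀ {n} {f : Code O (suc n)} {xs : Vec ℕ n} {k} →
           (∀ i → i ℕ.< k → ∃[ y ] (φ ⊢ f · (i ∷ xs) ⇓ suc y)) → φ ⊢ f · (k ∷ xs) ⇓ 0 →
           φ ⊢ minᶜ f · xs ⇓ k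

-- Partial recursive functions, given by oracle-free programs.
PR : ℕ → Set
PR = Code ⊥

infix 4 _·_⇓_
_·_⇓_ : ∀ {n} → PR n → Vec ℕ n → ℕ → Set
e · xs ⇓ y = (λ ()) ⊢ e · xs ⇓ y

Recursive₂ : Pred (ℕ → ℕ → ℕ) 0ℓ
Recursive₂ f = Σ[ e ∈ PR 2 ] (∀ m n → e · (m ∷ n ∷ []) ⇓ f m n)

infix 4 _≤T_ _≤w_
_≤T_ : (X Y : ℕ → ℕ) → Set
X ≤T Y = Σ[ e ∈ Code ⊤ 1 ] (∀ n → (λ (_ : ⊤) → Y) ⊢ e · (n ∷ []) ⇓ X n)

_≤w_ : (P Q : Pred (ℕ → ℕ) 0ℓ) → Set
P ≤w Q = ∀ Y → Q Y → ∃[ X ] (P X × X ≤T Y)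

-- Reals are Cauchy sequences of rationals; equal reals may be represented by
-- different sequences, and only _<ℝ_ and _≤ℝ_ are ever used to compare them.

IsCauchy : Pred (ℕ → ℚ) 0ℓ
IsCauchy x = ∀ ε → 0ℚ ℚ.< ε →
  ∃[ N ] (∀ m n → N ℕ.≤ m → N ℕ.≤ n → ℚ.∣ x m ℚ.- x n ∣ ℚ.< ε)

record ℝ : Set where
  constructor mkℝ
  field
    seq    : ℕ → ℚ
    cauchy : IsCauchy seq
open ℝ public

infix 4 _<ℝ_ _≤ℝ_
_<ℝ_ : ℝ → ℝ → Set
x <ℝ y = ∃[ ε ] (0ℚ ℚ.< ε × ∃[ N ] (∀ n → N ℕ.≤ n → seq x n ℚ.+ ε ℚ.≤ seq y n))

_≤ℝ_ : ℝ → ℝ → Set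
x ≤ℝ y = ∀ ε → 0ℚ ℚ.< ε → ∃[ N ] (∀ n → N ℕ.≤ n → seq x n ℚ.≤ seq y n ℚ.+ ε)

private
  ½ε : ∀ ε → 0ℚ ℚ.< ε → 0ℚ ℚ.< ℚ.½ ℚ.* ε
  ½ε ε 0<ε = subst (ℚ._< ℚ.½ ℚ.* ε) (ℚₚ.*-zeroʳ ℚ.½) (ℚₚ.*-monoʳ-<-pos ℚ.½ 0<ε)

  ½+½ : ∀ ε → ℚ.½ ℚ.* ε ℚ.+ ℚ.½ ℚ.* ε ≡ ε
  ½+½ ε = trans (sym (ℚₚ.*-distribʳ-+ ε ℚ.½ ℚ.½)) (ℚₚ.*-identityˡ ε)

  open import Data.Rational.Solver
  open +-*-Solver

  swap-diff : ∀ a b c d → (a ℚ.+ b) ℚ.- (c ℚ.+ d) ≡ (a ℚ.- c) ℚ.+ (b ℚ.- d)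
  swap-diff = solve 4 (λ a b c d → (a :+ b) :- (c :+ d) := (a :- c) :+ (b :- d)) refl

  neg-diff : ∀ a b → (ℚ.- a) ℚ.- (ℚ.- b) ≡ ℚ.- (a ℚ.- b)
  neg-diff = solve 2 (λ a b → (:- a) :- (:- b) := :- (a :- b)) refl

  cross : ∀ a b u v → u ℚ.* a ≡ 1ℚ → v ℚ.* b ≡ 1ℚ → u ℚ.- v ≡ (u ℚ.* v) ℚ.* (b ℚ.- a)
  cross a b u v ua vb = begin
    u ℚ.- v                             ≡⟨ cong₂ ℚ._-_ (ℚₚ.*-identityʳ u) (ℚₚ.*-identityʳ v) ⟨
    u ℚ.* 1ℚ ℚ.- v ℚ.* 1ℚ               ≡⟨ cong₂ (λ s t → u ℚ.* s ℚ.- v ℚ.* t) vb ua ⟨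
    u ℚ.* (v ℚ.* b) ℚ.- v ℚ.* (u ℚ.* a) ≡⟨ solve 4 (λ a b u v → u :* (v :* b) :- v :* (u :* a) := (u :* v) :* (b :- a)) refl a b u v ⟩
    (u ℚ.* v) ℚ.* (b ℚ.- a)             ∎
    where open ≡-Reasoning

constant : ℚ → ℝ
constant p = mkℝ (λ _ → p) λ ε 0<ε → 0 , λ _ _ _ _ →
  subst (ℚ._< ε) (sym (cong ℚ.∣_∣ (ℚₚ.+-inverseʳ p))) 0<ε

fromℕ : ℕ → ℝ
fromℕ n = constant (+ n ℚ./ 1)

infixl 6 _+ℝ_ _-ℝ_
_+ℝ_ : ℝ → ℝ → ℝ
x +ℝ y = mkℝ (λ n → seq x n ℚ.+ seq y n) λ ε 0<ε →
  let h = ℚ.½ ℚ.* ε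
      (M , p) = cauchy x h (½ε ε 0<ε)
      (N , q) = cauchy y h (½ε ε 0<ε)
  in M ℕ.⊔ N , λ m n m≥ n≥ → begin-strict
    ℚ.∣ (seq x m ℚ.+ seq y m) ℚ.- (seq x n ℚ.+ seq y n) ∣
      ≡⟨ cong ℚ.∣_∣ (swap-diff (seq x m) (seq y m) (seq x n) (seq y n)) ⟩
    ℚ.∣ (seq x m ℚ.- seq x n) ℚ.+ (seq y m ℚ.- seq y n) ∣
      ≤⟨ ℚₚ.∣p+q∣≤∣p∣+∣q∣ (seq x m ℚ.- seq x n) (seq y m ℚ.- seq y n) ⟩
    ℚ.∣ seq x m ℚ.- seq x n ∣ ℚ.+ ℚ.∣ seq y m ℚ.- seq y n ∣
      <⟨ ℚₚ.+-mono-< (p m n (ℕₚ.m⊔n≤o⇒m≤o M N m≥) (ℕₚ.m⊔n≤o⇒m≤o M N n≥))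
                     (q m n (ℕₚ.m⊔n≤o⇒n≤o M N m≥) (ℕₚ.m⊔n≤o⇒n≤o M N n≥)) ⟩
    h ℚ.+ h ≡⟨ ½+½ ε ⟩
    ε ∎
  where open ℚₚ.≤-Reasoning

-ℝ_ : ℝ → ℝ
-ℝ x = mkℝ (λ n → ℚ.- seq x n) λ ε 0<ε →
  let (N , p) = cauchy x ε 0<ε
  in N , λ m n m≥ n≥ → subst (ℚ._< ε)
       (sym (trans (cong ℚ.∣_∣ (neg-diff (seq x m) (seq x n))) (ℚₚ.∣-p∣≡∣p∣ (seq x m ℚ.- seq x n))))
       (p m n m≥ n≥)

_-ℝ_ : ℝ → ℝ → ℝ
x -ℝ y = x +ℝ (-ℝ y)

infixr 8 _×ℝ_
_×ℝ_ : ℕ → ℝ → ℝ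
zero  ×ℝ x = constant 0ℚ
suc n ×ℝ x = x +ℝ (n ×ℝ x)

-- The reciprocal, with the junk value 0 at 0.
recip : ℚ → ℚ
recip p with p ℚ.≟ 0ℚ
... | yes _  = 0ℚ
... | no p≢0 = (ℚ.1/ p) {{ℚ.≢-nonZero p≢0}}

private
  recip-inverse : ∀ p → 0ℚ ℚ.< p → recip p ℚ.* p ≡ 1ℚ
  recip-inverse p 0<p with p ℚ.≟ 0ℚ
  ... | yes p≡0 = contradiction (sym p≡0) (ℚₚ.<⇒≢ 0<p)
  ... | no p≢0  = ℚₚ.*-inverseˡ p {{ℚ.≢-nonZero p≢0}}

  recip-pos : ∀ p → 0ℚ ℚ.< p → 0ℚ ℚ.< recip p
  recip-pos p 0<p = ℚₚ.*-cancelʳ-<-nonNeg p {{ℚ.nonNegative (ℚₚ.<⇒≤ 0<p)}}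
    (subst₂ ℚ._<_ (sym (ℚₚ.*-zeroˡ p)) (sym (recip-inverse p 0<p)) (ℚₚ.positive⁻¹ 1ℚ))

  *-pos : ∀ {p q} → 0ℚ ℚ.< p → 0ℚ ℚ.< q → 0ℚ ℚ.< p ℚ.* q
  *-pos {p} {q} 0<p 0<q =
    subst (ℚ._< p ℚ.* q) (ℚₚ.*-zeroʳ p) (ℚₚ.*-monoʳ-<-pos p {{ℚ.positive 0<p}} 0<q)

  recip-anti : ∀ p q → 0ℚ ℚ.< p → p ℚ.≤ q → recip q ℚ.≤ recip p
  recip-anti p q 0<p p≤q = begin
    recip q                     ≡⟨ ℚₚ.*-identityʳ (recip q) ⟨
    recip q ℚ.* 1ℚ              ≡⟨ cong (recip q ℚ.*_) (recip-inverse p 0<p) ⟨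
    recip q ℚ.* (recip p ℚ.* p) ≤⟨ ℚₚ.*-monoˡ-≤-nonNeg (recip q) {{nn q 0<q}} (ℚₚ.*-monoˡ-≤-nonNeg (recip p) {{nn p 0<p}} p≤q) ⟩
    recip q ℚ.* (recip p ℚ.* q) ≡⟨ solve 3 (λ a b c → a :* (b :* c) := b :* (a :* c)) refl (recip q) (recip p) q ⟩
    recip p ℚ.* (recip q ℚ.* q) ≡⟨ cong (recip p ℚ.*_) (recip-inverse q 0<q) ⟩
    recip p ℚ.* 1ℚ              ≡⟨ ℚₚ.*-identityʳ (recip p) ⟩
    recip p                     ∎
    where
    open ℚₚ.≤-Reasoning
    0<q = ℚₚ.<-≤-trans 0<p p≤q
    nn : ∀ r → 0ℚ ℚ.< r → ℚ.NonNegative (recip r)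
    nn r 0<r = ℚ.nonNegative (ℚₚ.<⇒≤ (recip-pos r 0<r))

  recip-close : ∀ a b c ε → 0ℚ ℚ.< c → c ℚ.≤ a → c ℚ.≤ b →
                ℚ.∣ b ℚ.- a ∣ ℚ.< (c ℚ.* c) ℚ.* ε → ℚ.∣ recip a ℚ.- recip b ∣ ℚ.< ε
  recip-close a b c ε 0<c c≤a c≤b near = begin-strict
    ℚ.∣ u ℚ.- v ∣                            ≡⟨ cong ℚ.∣_∣ (cross a b u v (recip-inverse a 0<a) (recip-inverse b 0<b)) ⟩
    ℚ.∣ (u ℚ.* v) ℚ.* (b ℚ.- a) ∣            ≡⟨ ℚₚ.∣p*q∣≡∣p∣*∣q∣ (u ℚ.* v) (b ℚ.- a) ⟩
    ℚ.∣ u ℚ.* v ∣ ℚ.* ℚ.∣ b ℚ.- a ∣          ≡⟨ cong (ℚ._* ℚ.∣ b ℚ.- a ∣) (ℚₚ.0≤p⇒∣p∣≡p (ℚₚ.<⇒≤ 0<uv)) ⟩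
    (u ℚ.* v) ℚ.* ℚ.∣ b ℚ.- a ∣              ≤⟨ ℚₚ.*-monoʳ-≤-nonNeg (ℚ.∣ b ℚ.- a ∣) {{ℚ.nonNegative (ℚₚ.0≤∣p∣ (b ℚ.- a))}} uv≤ww ⟩
    (w ℚ.* w) ℚ.* ℚ.∣ b ℚ.- a ∣              <⟨ ℚₚ.*-monoʳ-<-pos (w ℚ.* w) {{ℚ.positive (*-pos 0<w 0<w)}} near ⟩
    (w ℚ.* w) ℚ.* ((c ℚ.* c) ℚ.* ε)          ≡⟨ solve 3 (λ w c ε → (w :* w) :* ((c :* c) :* ε) := (w :* c) :* ((w :* c) :* ε)) refl w c ε ⟩
    (w ℚ.* c) ℚ.* ((w ℚ.* c) ℚ.* ε)          ≡⟨ cong (λ t → t ℚ.* (t ℚ.* ε)) (recip-inverse c 0<c) ⟩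
    1ℚ ℚ.* (1ℚ ℚ.* ε)                        ≡⟨ trans (ℚₚ.*-identityˡ (1ℚ ℚ.* ε)) (ℚₚ.*-identityˡ ε) ⟩
    ε                                        ∎
    where
    open ℚₚ.≤-Reasoning
    u = recip a
    v = recip b
    w = recip c
    0<a = ℚₚ.<-≤-trans 0<c c≤a
    0<b = ℚₚ.<-≤-trans 0<c c≤b
    0<w = recip-pos c 0<c
    0<uv = *-pos (recip-pos a 0<a) (recip-pos b 0<b)
    uv≤ww : u ℚ.* v ℚ.≤ w ℚ.* w
    uv≤ww = ℚₚ.≤-trans
      (ℚₚ.*-monoʳ-≤-nonNeg v {{ℚ.nonNegative (ℚₚ.<⇒≤ (recip-pos b 0<b))}} (recip-anti c a 0<c c≤a))
      (ℚₚ.*-monoˡ-≤-nonNeg w {{ℚ.nonNegative (ℚₚ.<⇒≤ 0<w)}} (recip-anti c b 0<c c≤b))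

infix 9 _⁻¹[_]
_⁻¹[_] : (x : ℝ) → constant 0ℚ <ℝ x → ℝ
x ⁻¹[ c , 0<c , M , c≤x ] = mkℝ (λ n → recip (seq x n)) λ ε 0<ε →
  let (N , p) = cauchy x ((c ℚ.* c) ℚ.* ε) (*-pos (*-pos 0<c 0<c) 0<ε)
      low = λ n n≥ → subst (ℚ._≤ seq x n) (ℚₚ.+-identityˡ c) (c≤x n (ℕₚ.m⊔n≤o⇒m≤o M N n≥))
  in M ℕ.⊔ N , λ m n m≥ n≥ →
       recip-close (seq x m) (seq x n) c ε 0<c (low m m≥) (low n n≥)
         (p n m (ℕₚ.m⊔n≤o⇒n≤o M N n≥) (ℕₚ.m⊔n≤o⇒n≤o M N m≥))

1<⇒0< : ∀ {x} → constant 1ℚ <ℝ x → constant 0ℚ <ℝ x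
1<⇒0< (ε , 0<ε , N , p) =
  ε , 0<ε , N , λ n n≥ → ℚₚ.≤-trans (ℚₚ.+-monoˡ-≤ ε (ℚₚ.<⇒≤ (ℚₚ.positive⁻¹ 1ℚ))) (p n n≥)

sumBelow : (ℕ → ℝ) → ℕ → ℝ
sumBelow x zero    = constant 0ℚ
sumBelow x (suc N) = sumBelow x N +ℝ x N

-- The reals x 0, x 1, … are uniformly computable: a recursive double sequence
-- of rationals r n k = (a n k - b n k) / (d n k + 1) satisfies |x n - r n k| ≤ 2⁻ᵏ.
UniformlyComputable : Pred (ℕ → ℝ) 0ℓ
UniformlyComputable x =
  ∃[ a ] ∃[ b ] ∃[ d ] (Recursive₂ a × Recursive₂ b × Recursive₂ d ×
    (∀ n k → let r = constant ((a n k ⊖ b n k) ℚ./ suc (d n k))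
                 δ = constant ((+ 1 ℚ./ (2 ℕ.^ k)) {{ℕₚ.m^n≢0 2 k}})
             in (x n -ℝ r ≤ℝ δ) × (r -ℝ x n ≤ℝ δ)))

record IsOrder (q : ℕ → ℝ) : Set where
  field
    computable    : UniformlyComputable q
    nondecreasing : ∀ {m n} → m ℕ.≤ n → q m ≤ℝ q n
    unbounded     : ∀ (B : ℝ) → ∃[ n ] (B <ℝ q n)

MapsInto⟨1,∞⟩ : Pred (ℕ → ℝ) 0ℓ
MapsInto⟨1,∞⟩ q = ∀ n → constant 1ℚ <ℝ q n

SlowGrowing : (q : ℕ → ℝ) → MapsInto⟨1,∞⟩ q → Set
SlowGrowing q 1<q =
  ∀ (B : ℝ) → ∃[ N ] (B <ℝ sumBelow (λ n → q n ⁻¹[ 1<⇒0< {q n} (1<q n) ]) N)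

LinearlyUniversal : Pred (PR 1) 0ℓ
LinearlyUniversal ψ = ∀ (θ : PR 1) → ∃[ a ] ∃[ b ]
  (∀ x y → ψ · (a ℕ.* x ℕ.+ b ∷ []) ⇓ y ⇔ θ · (x ∷ []) ⇓ y)

LUA : (ℕ → ℝ) → Pred (ℕ → ℕ) 0ℓ
LUA p X = (∀ n → fromℕ (X n) <ℝ p n) ×
  Σ[ ψ ∈ PR 1 ] (LinearlyUniversal ψ × ¬ (∃[ n ] (ψ · (n ∷ []) ⇓ X n)))

LUAslow : Pred (ℕ → ℕ) 0ℓ
LUAslow X = ∃[ q ] Σ[ 1<q ∈ MapsInto⟨1,∞⟩ q ] (IsOrder q × SlowGrowing q 1<q × LUA q X)

String : Set
String = List Bit

-- Bijective base-2 numeration: a computable bijection between strings and ℕ.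
encode : String → ℕ
encode = foldr (λ b n → suc (toℕ b ℕ.+ 2 ℕ.* n)) 0

infix 4 _⟨_⟩≃_
_⟨_⟩≃_ : PR 1 → String → String → Set
M ⟨ σ ⟩≃ τ = M · (encode σ ∷ []) ⇓ encode τ

Dom : PR 1 → Pred String 0ℓ
Dom M σ = ∃[ τ ] (M ⟨ σ ⟩≃ τ)

PrefixFreeMachine : Pred (PR 1) 0ℓ
PrefixFreeMachine M = ∀ {σ τ} → Dom M σ → Dom M τ → Prefix _≡_ σ τ → σ ≡ τ

record Universal (U : PR 1) : Set where
  field
    prefixFree : PrefixFreeMachine U
    simulates  : ∀ M → PrefixFreeMachine M →
                 ∃[ ρ ] (∀ τ υ → U ⟨ ρ ⌢ τ ⟩≃ υ ⇔ M ⟨ τ ⟩≃ υ)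

-- K[ U ] σ ≡ k : the least length of a U-program for σ is k.  If U is universal,
-- such a k exists for every σ.
K[_]_≡_ : PR 1 → String → ℕ → Set
K[ U ] σ ≡ k = (∃[ τ ] (length τ ≡ k × U ⟨ τ ⟩≃ σ)) × (∀ τ → U ⟨ τ ⟩≃ σ → k ℕ.≤ length τ)

substring : (ℕ → Bit) → ℕ → ℕ → String
substring X i l = applyUpTo (λ j → X (i ℕ.+ j)) l

ShiftComplex : PR 1 → Pred (ℕ → Bit) 0ℓ
ShiftComplex U X = ∃[ δ ] (constant 0ℚ <ℝ δ × δ <ℝ constant 1ℚ × ∃[ c ]
  (∀ i l → let τ = substring X i l in
   ∀ k → K[ U ] τ ≡ k → (length τ ×ℝ δ) -ℝ fromℕ c ≤ℝ fromℕ k))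

-- {0,1}^ℕ is viewed as a subset of ℕ^ℕ.
SC : PR 1 → Pred (ℕ → ℕ) 0ℓ
SC U X = Σ[ B ∈ (ℕ → Bit) ] (X ≗ toℕ ∘ B × ShiftComplex U B)

{-# OPTIONS --safe #-}

-- A recursive bound is constant on blocks, each long enough to contribute 1 to the sum of the
-- reciprocals, and jumps so high between them that forcing with bushy trees works: a condition
-- is a finite string together with a set of bad strings that is small above it, i.e. contains
-- the leaves of no h-branching tree. At first the bad strings are those that meet the linearly
-- universal function ψ, which is obtained from U since prefixing a program by ρ is linear in
-- its code. Given an oracle program Γ, go to the start σ of a new block. If the strings on
-- which Γ converges at the number n assigned to the block are not big above σ, declare them
-- bad. Otherwise, by the pigeonhole principle, some value is output on the leaves of a bushy
-- tree; a machine that knows only σ finds such a value, and some leaf is not bad. So Γ yields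
-- infinitely often a string of length n with a program that is only as long as the code of σ
-- in unary, and n was chosen much larger than that.
module Submission where

open import Axiom.ExcludedMiddle using (ExcludedMiddle)
open import Data.Digit using (Bit)
open import Data.Empty using (⊥)
open import Data.Fin using (Fin; zero; suc; toℕ; fromℕ<; _↑ʳ_)
open import Data.Fin.Patterns
open import Data.Fin.Properties using (fromℕ<-toℕ; toℕ<n)
open import Data.List using (List; []; _∷_; length) renaming (_++_ to _⌢_)
open import Data.List.Properties using (length-++; applyUpTo-∷ʳ; length-applyUpTo)
open import Data.List.Relation.Binary.Prefix.Heterogeneous using (Prefix; []; _∷_)
open import Data.Product using (Σ-syntax; ∃-syntax; _×_; _,_; proj₁; proj₂)
open import Data.Sum using (_⊎_; inj₁; inj₂; [_,_]′)
open import Data.Unit using (⊤; tt)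
open import Data.Vec using (Vec; []; _∷_; head; tail; lookup; map; tabulate; take; drop; _++_)
open import Data.Vec.Properties using (tabulate∘lookup; tabulate-cong; lookup-++ʳ; take++drop≡id)
open import Data.Vec.Relation.Binary.Pointwise.Inductive using (Pointwise; []; _∷_)
open import Function using (_∘_; id; _⇔_; mk⇔; Equivalence)
open import Function.Properties.Equivalence using () renaming (trans to ⇔-trans)
open import Level using (0ℓ)
open import Relation.Binary.Definitions using (tri<; tri≈; tri>)
open import Relation.Binary.PropositionalEquality
open import Relation.Nullary using (¬_; Dec; yes; no; contradiction)
open import Relation.Unary using (Pred; _∪_; _⊆_)
open import Defs

-- The search for a monochromatic tree must be effective, whereas the bad set need not be recursive.
-- Hence the machine ignores the bad set and accepts any `a`-branching tree that yields a single
-- value: the bad set is `a`-small above σ, so every such tree has a leaf that is not bad. If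
-- several values are possible, it does not matter which one is found, since the stem is extended
-- afterwards so as to make that value the true one. The constants look circular: the gap at a
-- breakpoint `a` depends on `point a`, which must exceed a multiple of the codes of strings of
-- length `a`, whose entries are limited by the earlier gaps. But a block is as long as its gap and
-- ends by the next breakpoint, so all earlier gaps are at most `a`, and `maxInput a` can be defined
-- from `a` alone. Convergence of Γ is an unbounded event. It becomes decidable when all leaves are
-- grown to one common level, the length of a leaf being both the length of the oracle and the time
-- bound; bigness is then computed from the leaves downwards.

-- Total recursive functions together with programs for them

module Recursive where

  open import Data.Nat
  open import Data.Nat.Properties

  private variable
    m n : ℕ
    O : Set
    φ : O → ℕ → ℕ

  mutual
    deterministic : {e : Code O n} {xs : Vec ℕ n} {y z : ℕ} →
                    φ ⊢ e · xs ⇓ y → φ ⊢ e · xs ⇓ z → y ≡ z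
    deterministic zero⇓ zero⇓ = refl
    deterministic suc⇓ suc⇓ = refl
    deterministic (proj⇓ i) (proj⇓ .i) = refl
    deterministic (query⇓ o) (query⇓ .o) = refl
    deterministic (comp⇓ ps p) (comp⇓ qs q) with refl ← deterministic* ps qs = deterministic p q
    deterministic (prec0⇓ p) (prec0⇓ q) = deterministic p q
    deterministic (precs⇓ p p′) (precs⇓ q q′) with refl ← deterministic p q = deterministic p′ q′
    deterministic (min⇓ {k = k} p p₀) (min⇓ {k = l} q q₀) with <-cmp k l
    ... | tri< k<l _ _ = contradiction (deterministic p₀ (proj₂ (q k k<l))) 0≢1+n
    ... | tri≈ _ k≡l _ = k≡l
    ... | tri> _ _ l<k = contradiction (deterministic q₀ (proj₂ (p l l<k))) 0≢1+n

    deterministic* : {gs : Vec (Code O n) m} {xs : Vec ℕ n} {ys zs : Vec ℕ m} →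
                     Pointwise (λ g y → φ ⊢ g · xs ⇓ y) gs ys →
                     Pointwise (λ g z → φ ⊢ g · xs ⇓ z) gs zs → ys ≡ zs
    deterministic* [] [] = refl
    deterministic* (p ∷ ps) (q ∷ qs) = cong₂ _∷_ (deterministic p q) (deterministic* ps qs)

  -- The program is polymorphic in the oracle symbols, so that the same function serves in
  -- oracle-free machines and inside reductions that query the generic sequence.
  record Rec (n : ℕ) : Set₁ where
    constructor mkRec
    field
      ⟦_⟧   : Vec ℕ n → ℕ
      code  : Code O n
      halts : ∀ {φ : O → ℕ → ℕ} xs → φ ⊢ code · xs ⇓ ⟦_⟧ xs
  open Rec public

  -- The program is kept and only its meaning is exchanged for an equal function, so that later
  -- goals mention the intended formula instead of the recursion that computes it.
  named : (f : Vec ℕ n → ℕ) (r : Rec n) → (∀ xs → ⟦ r ⟧ xs ≡ f xs) → Rec n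
  named f r eq = mkRec f (code r) (λ {O} {φ} xs → subst (φ ⊢ code r · xs ⇓_) (eq xs) (halts r xs))

  ⟦_⟧* : Vec (Rec n) m → Vec ℕ n → Vec ℕ m
  ⟦ [] ⟧*     xs = []
  ⟦ r ∷ rs ⟧* xs = ⟦ r ⟧ xs ∷ ⟦ rs ⟧* xs

  comp : Rec m → Vec (Rec n) m → Rec n
  comp {m} {n} r rs = mkRec (⟦ r ⟧ ∘ ⟦ rs ⟧*) (compᶜ (code r) (codes rs)) (λ xs → comp⇓ (halts* rs xs) (halts r _))
    where
    codes : ∀ {k} → Vec (Rec n) k → Vec (Code O n) k
    codes []       = []
    codes (r ∷ rs) = code r ∷ codes rs

    halts* : ∀ {k} {φ : O → ℕ → ℕ} (rs : Vec (Rec n) k) xs →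
             Pointwise (λ g y → φ ⊢ g · xs ⇓ y) (codes rs) (⟦ rs ⟧* xs)
    halts* []       xs = []
    halts* (r ∷ rs) xs = halts r xs ∷ halts* rs xs

  var : Fin n → Rec n
  var i = mkRec (λ xs → lookup xs i) (projᶜ i) (λ xs → proj⇓ i)

  vars : (Fin m → Fin n) → Vec (Rec n) m
  vars {zero}  ρ = []
  vars {suc m} ρ = var (ρ zero) ∷ vars (ρ ∘ suc)

  rest : ∀ k → Vec (Rec (k + n)) n
  rest k = vars (k ↑ʳ_)

  ⟦vars⟧ : (ρ : Fin m → Fin n) (xs : Vec ℕ n) → ⟦ vars ρ ⟧* xs ≡ tabulate (lookup xs ∘ ρ)
  ⟦vars⟧ {zero}  ρ xs = refl
  ⟦vars⟧ {suc m} ρ xs = cong (lookup xs (ρ zero) ∷_) (⟦vars⟧ (ρ ∘ suc) xs)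

  ⟦rest⟧ : ∀ {k} (ys : Vec ℕ k) (xs : Vec ℕ n) → ⟦ rest k ⟧* (ys ++ xs) ≡ xs
  ⟦rest⟧ {k = k} ys xs = begin
    ⟦ rest k ⟧* (ys ++ xs)              ≡⟨ ⟦vars⟧ (k ↑ʳ_) (ys ++ xs) ⟩
    tabulate (lookup (ys ++ xs) ∘ (k ↑ʳ_)) ≡⟨ tabulate-cong (lookup-++ʳ ys xs) ⟩
    tabulate (lookup xs)                ≡⟨ tabulate∘lookup xs ⟩
    xs                                  ∎
    where open ≡-Reasoning

  wk : ∀ k → Rec n → Rec (k + n)
  wk k r = named (λ xs → ⟦ r ⟧ (drop k xs)) (comp r (rest k)) λ xs →
    cong ⟦ r ⟧ (trans (cong ⟦ rest k ⟧* (sym (take++drop≡id k xs))) (⟦rest⟧ (take k xs) (drop k xs)))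

  succ : Rec n → Rec n
  succ r = comp (mkRec (λ xs → suc (head xs)) sucᶜ λ { (x ∷ []) → suc⇓ }) (r ∷ [])

  lit : ℕ → Rec n
  lit zero    = comp (mkRec (λ _ → 0) zeroᶜ λ { [] → zero⇓ }) []
  lit (suc k) = succ (lit k)

  rec : ℕ → (ℕ → ℕ → ℕ) → ℕ → ℕ
  rec b s zero    = b
  rec b s (suc k) = s k (rec b s k)

  rec-cong : ∀ b {s s′ : ℕ → ℕ → ℕ} → (∀ i x → s i x ≡ s′ i x) → ∀ k → rec b s k ≡ rec b s′ k
  rec-cong b eq zero    = refl
  rec-cong b {s} eq (suc k) = trans (cong (s k) (rec-cong b eq k)) (eq k _)

  prec : Rec n → Rec (2 + n) → Rec (suc n)
  prec r s = mkRec (λ xs → rec (⟦ r ⟧ (tail xs)) (λ i a → ⟦ s ⟧ (i ∷ a ∷ tail xs)) (head xs))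
                   (precᶜ (code r) (code s)) (λ { (k ∷ xs) → go k xs })
    where
    go : ∀ {O} {φ : O → ℕ → ℕ} k xs →
         φ ⊢ precᶜ (code r) (code s) · (k ∷ xs) ⇓ rec (⟦ r ⟧ xs) (λ i a → ⟦ s ⟧ (i ∷ a ∷ xs)) k
    go zero    xs = prec0⇓ (halts r xs)
    go (suc k) xs = precs⇓ (go k xs) (halts s _)

  natrec : Rec n → Rec (2 + n) → Rec n → Rec n
  natrec r s t = named (λ xs → rec (⟦ r ⟧ xs) (λ i a → ⟦ s ⟧ (i ∷ a ∷ xs)) (⟦ t ⟧ xs))
    (comp (prec r s) (t ∷ rest 0))
    (λ xs → cong (λ ys → rec (⟦ r ⟧ ys) (λ i a → ⟦ s ⟧ (i ∷ a ∷ ys)) (⟦ t ⟧ xs)) (⟦rest⟧ [] xs))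

  infixl 6 _+ᴿ_ _∸ᴿ_
  infixl 7 _*ᴿ_

  _+ᴿ_ : Rec n → Rec n → Rec n
  r +ᴿ s = named (λ xs → ⟦ r ⟧ xs + ⟦ s ⟧ xs) (natrec s (succ (var 1F)) r) λ xs → go (⟦ s ⟧ xs) (⟦ r ⟧ xs)
    where
    go : ∀ b k → rec b (λ _ a → suc a) k ≡ k + b
    go b zero    = refl
    go b (suc k) = cong suc (go b k)

  _*ᴿ_ : Rec n → Rec n → Rec n
  r *ᴿ s = named (λ xs → ⟦ r ⟧ xs * ⟦ s ⟧ xs) (natrec (lit 0) (wk 2 s +ᴿ var 1F) r) λ xs → go (⟦ s ⟧ xs) (⟦ r ⟧ xs)
    where
    go : ∀ b k → rec 0 (λ _ a → b + a) k ≡ k * b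
    go b zero    = refl
    go b (suc k) = cong (b +_) (go b k)

  predᴿ : Rec n → Rec n
  predᴿ r = named (λ xs → pred (⟦ r ⟧ xs)) (natrec (lit 0) (var 0F) r) λ xs → go (⟦ r ⟧ xs)
    where
    go : ∀ k → rec 0 (λ i _ → i) k ≡ pred k
    go zero    = refl
    go (suc k) = refl

  _∸ᴿ_ : Rec n → Rec n → Rec n
  r ∸ᴿ s = named (λ xs → ⟦ r ⟧ xs ∸ ⟦ s ⟧ xs) (natrec r (predᴿ (var 1F)) s) λ xs → go (⟦ r ⟧ xs) (⟦ s ⟧ xs)
    where
    go : ∀ b k → rec b (λ _ a → pred a) k ≡ b ∸ k
    go b zero    = refl
    go b (suc k) = trans (cong pred (go b k)) (pred[m∸n]≡m∸[1+n] b k)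

  2^ᴿ_ : Rec n → Rec n
  2^ᴿ r = named (λ xs → 2 ^ ⟦ r ⟧ xs) (natrec (lit 1) (lit 2 *ᴿ var 1F) r) λ xs → go (⟦ r ⟧ xs)
    where
    go : ∀ k → rec 1 (λ _ a → 2 * a) k ≡ 2 ^ k
    go zero    = refl
    go (suc k) = cong (2 *_) (go k)

  ifz : ℕ → ℕ → ℕ → ℕ
  ifz zero    x y = x
  ifz (suc _) x y = y

  ifzᴿ : Rec n → Rec n → Rec n → Rec n
  ifzᴿ r s t = named (λ xs → ifz (⟦ r ⟧ xs) (⟦ s ⟧ xs) (⟦ t ⟧ xs)) (natrec s (wk 2 t) r) λ xs →
    go (⟦ s ⟧ xs) (⟦ t ⟧ xs) (⟦ r ⟧ xs)
    where
    go : ∀ x y k → rec x (λ _ _ → y) k ≡ ifz k x y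
    go x y zero    = refl
    go x y (suc k) = refl

  Σ< : ℕ → (ℕ → ℕ) → ℕ
  Σ< n f = rec 0 (λ i a → a + f i) n

  sumᴿ : Rec n → Rec (suc n) → Rec n
  sumᴿ r s = named (λ xs → Σ< (⟦ r ⟧ xs) (λ i → ⟦ s ⟧ (i ∷ xs)))
    (natrec (lit 0) (var 1F +ᴿ comp s (var 0F ∷ rest 2)) r) λ xs →
      rec-cong 0 (λ i a → cong (λ ys → a + ⟦ s ⟧ (i ∷ ys)) (⟦rest⟧ (i ∷ a ∷ []) xs)) (⟦ r ⟧ xs)

  eqᴿ : Rec n → Rec n → Rec n
  eqᴿ r s = lit 1 ∸ᴿ ((r ∸ᴿ s) +ᴿ (s ∸ᴿ r))

-- Pairing, and finite sets coded by binary digits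

module Pairing where

  open import Data.Nat
  open import Data.Nat.Properties
  open import Data.Nat.Tactic.RingSolver using (solve-∀)
  open Recursive

  private variable
    n : ℕ

  eq : ℕ → ℕ → ℕ
  eq x y = 1 ∸ ((x ∸ y) + (y ∸ x))

  eq-refl : ∀ x → eq x x ≡ 1
  eq-refl x rewrite n∸n≡0 x = refl

  eq-≢ : ∀ {x y} → x ≢ y → eq x y ≡ 0
  eq-≢ {x} {y} x≢y = m≤n⇒m∸n≡0 (n≢0⇒n>0 λ sum≡0 → x≢y (≤-antisym
    (m∸n≡0⇒m≤n (m+n≡0⇒m≡0 (x ∸ y) sum≡0)) (m∸n≡0⇒m≤n (m+n≡0⇒n≡0 (x ∸ y) sum≡0))))

  Σ<-zero : ∀ n {f} → (∀ i → i < n → f i ≡ 0) → Σ< n f ≡ 0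
  Σ<-zero zero    f≡0 = refl
  Σ<-zero (suc n) f≡0 = cong₂ _+_ (Σ<-zero n (λ i i<n → f≡0 i (m<n⇒m<1+n i<n))) (f≡0 n ≤-refl)

  Σ<-single : ∀ n {f} k → k < n → (∀ i → i ≢ k → f i ≡ 0) → Σ< n f ≡ f k
  Σ<-single (suc n) {f} k k<1+n f≡0 with k ≟ n
  ... | yes refl = cong (_+ f k) (Σ<-zero n (λ i i<k → f≡0 i (<⇒≢ i<k)))
  ... | no k≢n   = trans (cong₂ _+_ (Σ<-single n k (≤∧≢⇒< (s≤s⁻¹ k<1+n) k≢n) f≡0) (f≡0 n (k≢n ∘ sym)))
                         (+-identityʳ (f k))

  -- For a fixed first component this pairing is affine in the second, which is what linear
  -- universality asks for. It exceeds both components, so it can be inverted by bounded search.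
  pair : ℕ → ℕ → ℕ
  pair a b = 2 ^ a * suc (2 * b)

  pair-zero : ∀ b → pair 0 b ≡ suc (2 * b)
  pair-zero b = *-identityˡ (suc (2 * b))

  pair-suc : ∀ a b → pair (suc a) b ≡ 2 * pair a b
  pair-suc a b = *-assoc 2 (2 ^ a) (suc (2 * b))

  pair-injective : ∀ a b c d → pair a b ≡ pair c d → a ≡ c × b ≡ d
  pair-injective zero b zero d p = refl ,
    *-cancelˡ-≡ b d 2 (suc-injective (trans (sym (pair-zero b)) (trans p (pair-zero d))))
  pair-injective zero b (suc c) d p =
    contradiction (trans (sym (pair-suc c d)) (trans (sym p) (pair-zero b))) (even≢odd (pair c d) b)
  pair-injective (suc a) b zero d p =
    contradiction (trans (sym (pair-suc a b)) (trans p (pair-zero d))) (even≢odd (pair a b) d)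
  pair-injective (suc a) b (suc c) d p
    with refl , refl ← pair-injective a b c d
           (*-cancelˡ-≡ (pair a b) (pair c d) 2 (trans (sym (pair-suc a b)) (trans p (pair-suc c d)))) =
    refl , refl

  2^-mono : ∀ {m n} → m ≤ n → 2 ^ m ≤ 2 ^ n
  2^-mono = ^-monoʳ-≤ 2

  n<2^n : ∀ n → n < 2 ^ n
  n<2^n zero    = s≤s z≤n
  n<2^n (suc n) = +-mono-≤ (m^n>0 2 n) (≤-trans (n<2^n n) (m≤m+n (2 ^ n) 0))

  pair-mono : ∀ {a b c d} → a ≤ c → b ≤ d → pair a b ≤ pair c d
  pair-mono a≤c b≤d = *-mono-≤ (2^-mono a≤c) (s≤s (*-monoʳ-≤ 2 b≤d))

  a<pair : ∀ a b → a < pair a b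
  a<pair a b = ≤-trans (n<2^n a) (m≤m*n (2 ^ a) (suc (2 * b)))

  b<pair : ∀ a b → b < pair a b
  b<pair a b = ≤-trans (s≤s (m≤m+n b (b + 0))) (m≤n*m (suc (2 * b)) (2 ^ a) {{m^n≢0 2 a}})

  -- `pair a d` is positive, so its successor is at most its double, which is `pair (suc a) d`.
  pair-strict : ∀ {a b c d} → a < c → b < d → pair a b < pair c d
  pair-strict {a} {b} {c} {d} a<c b<d = ≤-trans (s≤s (pair-mono {d = d} (≤-refl {a}) (<⇒≤ b<d)))
    (≤-trans (+-monoˡ-≤ (pair a d) (≤-trans (s≤s z≤n) (a<pair a d)))
    (≤-trans (≤-reflexive (double (2 ^ a) (suc (2 * d)))) (pair-mono {d = d} a<c ≤-refl)))
    where
    double : ∀ x y → x * y + x * y ≡ (2 * x) * y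
    double = solve-∀

  pairᴿ : Rec n → Rec n → Rec n
  pairᴿ r s = 2^ᴿ r *ᴿ succ (lit 2 *ᴿ s)

  private
    -- The factor `eq` annihilates every term of the double sum but the one at the true components,
    -- and injectivity of `pair` leaves only one such term.
    unpair : ∀ (w : ℕ → ℕ → ℕ) a b → let m = pair a b in
             Σ< m (λ c → Σ< m (λ d → w c d * eq (pair c d) m)) ≡ w a b
    unpair w a b = begin
      Σ< m (λ c → Σ< m (λ d → w c d * eq (pair c d) m))
        ≡⟨ Σ<-single m a (a<pair a b) (λ c c≢a → Σ<-zero m (λ d _ → vanish c d (c≢a ∘ proj₁))) ⟩
      Σ< m (λ d → w a d * eq (pair a d) m)
        ≡⟨ Σ<-single m b (b<pair a b) (λ d d≢b → vanish a d (d≢b ∘ proj₂)) ⟩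
      w a b * eq m m ≡⟨ cong (w a b *_) (eq-refl m) ⟩
      w a b * 1      ≡⟨ *-identityʳ (w a b) ⟩
      w a b          ∎
      where
      open ≡-Reasoning
      m = pair a b
      vanish : ∀ c d → ¬ (c ≡ a × d ≡ b) → w c d * eq (pair c d) m ≡ 0
      vanish c d ≢ = trans (cong (w c d *_) (eq-≢ (≢ ∘ pair-injective c d a b))) (*-zeroʳ (w c d))

  opaque
    π₁ π₂ : ℕ → ℕ
    π₁ m = Σ< m (λ a → Σ< m (λ b → a * eq (pair a b) m))
    π₂ m = Σ< m (λ a → Σ< m (λ b → b * eq (pair a b) m))

    π₁-pair : ∀ a b → π₁ (pair a b) ≡ a
    π₁-pair = unpair (λ a b → a)

    π₂-pair : ∀ a b → π₂ (pair a b) ≡ b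
    π₂-pair = unpair (λ a b → b)

    π₁-unfold : ∀ m → Σ< m (λ a → Σ< m (λ b → a * eq (pair a b) m)) ≡ π₁ m
    π₁-unfold m = refl

    π₂-unfold : ∀ m → Σ< m (λ a → Σ< m (λ b → b * eq (pair a b) m)) ≡ π₂ m
    π₂-unfold m = refl

  π₁ᴿ π₂ᴿ : Rec n → Rec n
  π₁ᴿ r = comp (named {1} (λ xs → π₁ (head xs))
    (sumᴿ (var 0F) (sumᴿ (var 1F) (var 1F *ᴿ eqᴿ (pairᴿ (var 1F) (var 0F)) (var 2F))))
    λ { (m ∷ []) → π₁-unfold m }) (r ∷ [])
  π₂ᴿ r = comp (named {1} (λ xs → π₂ (head xs))
    (sumᴿ (var 0F) (sumᴿ (var 1F) (var 0F *ᴿ eqᴿ (pairᴿ (var 1F) (var 0F)) (var 2F))))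
    λ { (m ∷ []) → π₂-unfold m }) (r ∷ [])

  -- `half` counts the odd numbers below its argument, which avoids division.
  par half : ℕ → ℕ
  par  = rec 0 (λ _ a → 1 ∸ a)
  half = rec 0 (λ i a → a + par i)

  bit : ℕ → ℕ → ℕ
  bit F y = par (rec F (λ _ → half) y)

  private
    par≤1 : ∀ n → par n ≤ 1
    par≤1 zero    = z≤n
    par≤1 (suc n) = m∸n≤m 1 (par n)

    shift : ∀ c z → c + 2 * suc z ≡ 2 + (c + 2 * z)
    shift = solve-∀

  par-2* : ∀ c z → c ≤ 1 → par (c + 2 * z) ≡ c
  par-2* (suc (suc c)) z    (s≤s ())
  par-2* zero          zero _ = refl
  par-2* (suc zero)    zero _ = refl
  par-2* c (suc z) c≤1 = begin
    par (c + 2 * suc z)       ≡⟨ cong par (shift c z) ⟩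
    1 ∸ (1 ∸ par (c + 2 * z)) ≡⟨ m∸[m∸n]≡n (par≤1 (c + 2 * z)) ⟩
    par (c + 2 * z)           ≡⟨ par-2* c z c≤1 ⟩
    c                         ∎
    where open ≡-Reasoning

  half-2* : ∀ c z → c ≤ 1 → half (c + 2 * z) ≡ z
  half-2* (suc (suc c)) z    (s≤s ())
  half-2* zero          zero _ = refl
  half-2* (suc zero)    zero _ = refl
  half-2* c (suc z) c≤1 = begin
    half (c + 2 * suc z)    ≡⟨ cong half (shift c z) ⟩
    half k + par k + (1 ∸ par k)   ≡⟨ +-assoc (half k) (par k) (1 ∸ par k) ⟩
    half k + (par k + (1 ∸ par k)) ≡⟨ cong (half k +_) (m+[n∸m]≡n (par≤1 k)) ⟩
    half k + 1              ≡⟨ +-comm (half k) 1 ⟩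
    suc (half k)            ≡⟨ cong suc (half-2* c z c≤1) ⟩
    suc z                   ∎
    where
    open ≡-Reasoning
    k = c + 2 * z

  -- A function from `N` numbers to {0,1} becomes a single number, so that a whole level of a tree
  -- can be the value carried through a primitive recursion.
  table : ℕ → (ℕ → ℕ) → ℕ
  table N c = Σ< N (λ x → 2 ^ x * c x)

  table-suc : ∀ N c → table (suc N) c ≡ c 0 + 2 * table N (c ∘ suc)
  table-suc zero    c = refl
  table-suc (suc N) c rewrite table-suc N c = ring (c 0) (table N (c ∘ suc)) (2 ^ N) (c (suc N))
    where
    ring : ∀ a b p d → a + 2 * b + (2 * p) * d ≡ a + 2 * (b + p * d)
    ring = solve-∀

  bit-table : ∀ N c → (∀ x → c x ≤ 1) → ∀ y → y < N → bit (table N c) y ≡ c y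
  bit-table (suc N) c c≤1 zero    _ = trans (cong par (table-suc N c)) (par-2* (c 0) (table N (c ∘ suc)) (c≤1 0))
  bit-table (suc N) c c≤1 (suc y) (s≤s y<N) = begin
    par (rec (table (suc N) c) (λ _ → half) (suc y)) ≡⟨ cong par (inner (table (suc N) c) y) ⟩
    par (rec (half (table (suc N) c)) (λ _ → half) y)
      ≡⟨ cong (λ F → bit F y) (trans (cong half (table-suc N c)) (half-2* (c 0) (table N (c ∘ suc)) (c≤1 0))) ⟩
    bit (table N (c ∘ suc)) y                         ≡⟨ bit-table N (c ∘ suc) (c≤1 ∘ suc) y y<N ⟩
    c (suc y)                                         ∎
    where
    open ≡-Reasoning
    inner : ∀ F y → rec F (λ _ → half) (suc y) ≡ rec (half F) (λ _ → half) y
    inner F zero    = refl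
    inner F (suc y) = cong half (inner F y)

-- The recursive bound, its blocks and its constants

module Bound where

  open import Data.Nat
  open import Data.Nat.Properties
  open Recursive
  open Pairing

  private variable
    n : ℕ

  tableᴿ : Rec n → Rec (suc n) → Rec n
  tableᴿ r s = sumᴿ r (2^ᴿ (var 0F) *ᴿ s)

  parᴿ halfᴿ : Rec n → Rec n
  parᴿ r  = natrec (lit 0) (lit 1 ∸ᴿ var 1F) r
  halfᴿ r = natrec (lit 0) (var 1F +ᴿ parᴿ (var 0F)) r

  bitᴿ : Rec n → Rec n → Rec n
  bitᴿ r s = parᴿ (natrec r (halfᴿ (var 1F)) s)

  -- This iterates the coding of strings with the entry `b` at each place, starting from 1 instead
  -- of 0. So it strictly exceeds the index of every string of length at most `a` with entries below
  -- `b`.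
  stringBound : ℕ → ℕ → ℕ
  stringBound a b = rec 1 (λ _ x → pair x b) a

  stringBoundᴿ : Rec n → Rec n → Rec n
  stringBoundᴿ r s = natrec (lit 1) (pairᴿ (var 1F) (wk 2 s)) r

  stringBound-mono : ∀ {a b c d} → a ≤ c → b ≤ d → stringBound a b ≤ stringBound c d
  stringBound-mono {zero} {c = c} {d} _ _ = pos c {d}
    where
    pos : ∀ c {d} → 1 ≤ stringBound c d
    pos zero        = ≤-refl
    pos (suc c) {d} = ≤-trans (s≤s z≤n) (a<pair (stringBound c d) d)
  stringBound-mono {suc a} {b} {suc c} {d} (s≤s a≤c) b≤d =
    pair-mono {stringBound a b} {b} {stringBound c d} {d} (stringBound-mono a≤c b≤d) b≤d

  -- At a breakpoint a, a string σ of length a is given to the guessing machine as the input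
  -- pair a (index σ), which is at most maxInput a. The machine guesses the output at point a, a
  -- number below colours a whose program must be far shorter than point a. A tree that branches
  -- colours a * a times has a monochromatic subtree that branches a times, and gap a leaves room
  -- for avoiding a set that is a-small above σ in addition.
  opaque
    maxInput : ℕ → ℕ
    maxInput a = pair a (stringBound a a)

    maxInput-unfold : ∀ a → pair a (stringBound a a) ≡ maxInput a
    maxInput-unfold a = refl

    point : ℕ → ℕ
    point a = suc (a * (a + maxInput a))

    point-unfold : ∀ a → suc (a * (a + pair a (stringBound a a))) ≡ point a
    point-unfold a = refl

    -- The final contradiction: once `a` dominates the reciprocal of δ and all additive constants,
    -- shift complexity would force `point a` to be at most the left side.
    <point : ∀ a → a * (a + maxInput a) < point a
    <point a = ≤-refl

    colours : ℕ → ℕ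
    colours a = 2 ^ suc (point a)

    colours-unfold : ∀ a → 2 ^ suc (point a) ≡ colours a
    colours-unfold a = refl

    maxInput-mono : ∀ {a b} → a ≤ b → maxInput a ≤ maxInput b
    maxInput-mono {a} {b} a≤b = pair-mono {d = stringBound b b} a≤b (stringBound-mono a≤b a≤b)

    point-mono : ∀ {a b} → a ≤ b → point a ≤ point b
    point-mono a≤b = s≤s (*-mono-≤ a≤b (+-mono-≤ a≤b (maxInput-mono a≤b)))

    colours-mono : ∀ {a b} → a ≤ b → colours a ≤ colours b
    colours-mono a≤b = 2^-mono (s≤s (point-mono a≤b))

  pointᴿ coloursᴿ : Rec n → Rec n
  pointᴿ r = named (λ xs → point (⟦ r ⟧ xs)) (succ (r *ᴿ (r +ᴿ pairᴿ r (stringBoundᴿ r r))))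
    (λ xs → point-unfold (⟦ r ⟧ xs))
  coloursᴿ r = named (λ xs → colours (⟦ r ⟧ xs)) (2^ᴿ (succ (pointᴿ r))) (λ xs → colours-unfold (⟦ r ⟧ xs))

  opaque
    -- The summand 2 matters at `a = 0`, where the other terms vanish: the bound must exceed 1, and
    -- the first condition has width 2 at the empty stem.
    gap : ℕ → ℕ
    gap a = 2 + (a + colours a * a)

    gap-unfold : ∀ a → 2 + (a + colours a * a) ≡ gap a
    gap-unfold a = refl

    gap-mono : ∀ {a b} → a ≤ b → gap a ≤ gap b
    gap-mono a≤b = s≤s (s≤s (+-mono-≤ a≤b (*-mono-≤ (colours-mono a≤b) a≤b)))

    2≤gap : ∀ a → 2 ≤ gap a
    2≤gap a = s≤s (s≤s z≤n)

    colours≤gap : ∀ a → a + colours a * a ≤ gap a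
    colours≤gap a = m≤n+m (a + colours a * a) 2

  gapᴿ : Rec n → Rec n
  gapᴿ r = named (λ xs → gap (⟦ r ⟧ xs)) (lit 2 +ᴿ (r +ᴿ coloursᴿ r *ᴿ r))
    (λ xs → gap-unfold (⟦ r ⟧ xs))

  -- start n is the breakpoint of the block [a, a + gap a) that contains n. As bound equals gap a
  -- on this block, each block contributes 1 to the sum of the reciprocals of bound.
  opaque
    start : ℕ → ℕ
    start = rec 0 (λ n s → ifz (s + gap s ∸ suc n) (suc n) s)

    start-unfold : ∀ n → rec 0 (λ n s → ifz (s + gap s ∸ suc n) (suc n) s) n ≡ start n
    start-unfold n = refl

    start-zero : start 0 ≡ 0
    start-zero = refl

    start-suc : ∀ n → (suc n < start n + gap (start n) × start (suc n) ≡ start n)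
                    ⊎ (start n + gap (start n) ≤ suc n × start (suc n) ≡ suc n)
    start-suc n with start n + gap (start n) ∸ suc n in eq
    ... | zero  = inj₂ (m∸n≡0⇒m≤n eq , refl)
    ... | suc _ = inj₁ (m∸n≢0⇒n<m (λ ≡0 → contradiction (trans (sym eq) ≡0) 1+n≢0) , refl)

    start≤ : ∀ n → start n ≤ n
    start≤ zero = z≤n
    start≤ (suc n) with start-suc n
    ... | inj₁ (_ , p) = ≤-trans (≤-reflexive p) (m≤n⇒m≤1+n (start≤ n))
    ... | inj₂ (_ , p) = ≤-reflexive p

  bound : ℕ → ℕ
  bound n = gap (start n)

  boundᴿ : Rec n → Rec n
  boundᴿ r = gapᴿ (named (λ xs → start (⟦ r ⟧ xs))
    (natrec (lit 0) (ifzᴿ ((var 1F +ᴿ gapᴿ (var 1F)) ∸ᴿ succ (var 0F)) (succ (var 0F)) (var 1F)) r)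
    (λ xs → start-unfold (⟦ r ⟧ xs)))

  start-blocks : ∀ {m n} → m ≤ n → start m ≡ start n ⊎ start m + gap (start m) ≤ start n
  start-blocks m≤n = go (≤⇒≤′ m≤n)
    where
    go : ∀ {m n} → m ≤′ n → start m ≡ start n ⊎ start m + gap (start m) ≤ start n
    go ≤′-refl = inj₁ refl
    go (≤′-step {n} m≤n) with go m≤n | start-suc n
    ... | inj₁ p | inj₁ (_ , r)  = inj₁ (trans p (sym r))
    ... | inj₂ p | inj₁ (_ , r)  = inj₂ (≤-trans p (≤-reflexive (sym r)))
    ... | inj₁ p | inj₂ (r≤ , r) =
      inj₂ (≤-trans (≤-reflexive (cong (λ s → s + gap s) p)) (≤-trans r≤ (≤-reflexive (sym r))))
    ... | inj₂ p | inj₂ (_ , r)  = inj₂ (≤-trans p (≤-trans (start≤ n) (≤-trans (n≤1+n n) (≤-reflexive (sym r)))))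

  start-mono : ∀ {m n} → m ≤ n → start m ≤ start n
  start-mono m≤n = [ ≤-reflexive , m+n≤o⇒m≤o _ ]′ (start-blocks m≤n)

  bound-mono : ∀ {m n} → m ≤ n → bound m ≤ bound n
  bound-mono m≤n = gap-mono (start-mono m≤n)

  2≤bound : ∀ n → 2 ≤ bound n
  2≤bound n = 2≤gap (start n)

  Breakpoint : ℕ → Set
  Breakpoint a = start a ≡ a

  start-breakpoint : ∀ n → Breakpoint (start n)
  start-breakpoint zero = cong start start-zero
  start-breakpoint (suc n) with start-suc n
  ... | inj₁ (_ , p) = trans (cong start p) (trans (start-breakpoint n) (sym p))
  ... | inj₂ (_ , p) = cong start p

  start-within : ∀ {a} i → Breakpoint a → i < gap a → start (a + i) ≡ a
  start-within {a} i p i<gap with start-blocks (m≤m+n a i)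
  ... | inj₁ q = trans (sym q) p
  ... | inj₂ q rewrite p = contradiction (≤-trans q (start≤ (a + i))) (<⇒≱ (+-monoʳ-< a i<gap))

  -- The last place of the block, `a + k` with `gap a` equal to `suc k`, still has start `a`, so the
  -- recursion must open a new block one place later.
  next-breakpoint : ∀ {a} → Breakpoint a → Breakpoint (a + gap a)
  next-breakpoint {a} p with gap a in eq | 2≤gap a
  ... | suc k | _ rewrite +-suc a k with start-suc (a + k)
  ...   | inj₁ (n< , _) rewrite start-within {a} k p (≤-reflexive (sym eq)) | eq | +-suc a k =
    contradiction n< (<-irrefl refl)
  ...   | inj₂ (_ , q) = trans (cong start refl) q

  -- The block of `i` has length `bound i` and ends by `a`. This breaks the apparent circle in the
  -- constants: entries of strings of length `a` are below `a`, whatever the earlier gaps were.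
  bound-below : ∀ {a i} → Breakpoint a → i < a → bound i ≤ a
  bound-below {a} {i} p i<a with start-blocks (<⇒≤ i<a)
  ... | inj₁ q = contradiction (≤-trans (≤-reflexive (sym (trans q p))) (start≤ i)) (<⇒≱ i<a)
  ... | inj₂ q = ≤-trans (m≤n+m (bound i) (start i)) (≤-trans q (≤-reflexive p))

  breakpoint-above : ∀ n → ∃[ a ] (n ≤ a × Breakpoint a)
  breakpoint-above zero    = 0 , z≤n , start-zero
  breakpoint-above (suc n) with a , n≤a , p ← breakpoint-above n =
    a + gap a , ≤-trans (≤-reflexive (+-comm 1 n)) (+-mono-≤ n≤a (<⇒≤ (2≤gap a))) , next-breakpoint p

-- Step-bounded evaluation with finite oracles

module OracleRuns where

  open import Data.Nat
  open import Data.Nat.Properties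
  open Recursive
  open Pairing
  open Bound

  private variable
    n m : ℕ

  -- The latest entry is the outermost pair, so `t ∸ suc i` pairs have to be stripped before entry
  -- `i` appears. The value 0 marks a query beyond the finite oracle.
  entry : ℕ → ℕ → ℕ → ℕ
  entry t x i = ifz (t ∸ i) 0 (suc (π₂ (rec x (λ _ → π₁) (t ∸ suc i))))

  entryᴿ : Rec n → Rec n → Rec n → Rec n
  entryᴿ t x i = ifzᴿ (t ∸ᴿ i) (lit 0) (succ (π₂ᴿ (natrec x (π₁ᴿ (var 1F)) (t ∸ᴿ succ i))))

  -- For values coded as in `run` the product is zero exactly when one of them is undefined, so a
  -- single `ifz` tests all arguments of a composition.
  product : Vec ℕ m → ℕ
  product []       = 1
  product (x ∷ xs) = x * product xs

  productᴿ : Vec (Rec n) m → Rec n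
  productᴿ []       = lit 1
  productᴿ (r ∷ rs) = r *ᴿ productᴿ rs

  ⟦productᴿ⟧ : (rs : Vec (Rec n) m) → ∀ xs → ⟦ productᴿ rs ⟧ xs ≡ product (⟦ rs ⟧* xs)
  ⟦productᴿ⟧ []       xs = refl
  ⟦productᴿ⟧ (r ∷ rs) xs = cong (⟦ r ⟧ xs *_) (⟦productᴿ⟧ rs xs)

  predᴿ* : Vec (Rec n) m → Vec (Rec n) m
  predᴿ* []       = []
  predᴿ* (r ∷ rs) = predᴿ r ∷ predᴿ* rs

  ⟦predᴿ*⟧ : (rs : Vec (Rec n) m) → ∀ xs → ⟦ predᴿ* rs ⟧* xs ≡ map pred (⟦ rs ⟧* xs)
  ⟦predᴿ*⟧ []       xs = refl
  ⟦predᴿ*⟧ (r ∷ rs) xs = cong (pred (⟦ r ⟧ xs) ∷_) (⟦predᴿ*⟧ rs xs)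

  -- The result of the search for the least zero below t of a function with values
  -- coded as in run: 0 while all values are positive, 1 after an undefined value.
  search : (ℕ → ℕ) → ℕ → ℕ
  search v = rec 0 (λ i a → ifz a (ifz (v i) 1 (ifz (pred (v i)) (suc (suc i)) 0)) a)

  -- run e t x xs is suc y if e outputs y on xs within t steps, for the finite oracle
  -- of length t coded by x, and 0 otherwise.
  mutual
    run : Code ⊤ n → ℕ → ℕ → Vec ℕ n → ℕ
    run zeroᶜ t x _ = 1
    run sucᶜ t x (y ∷ []) = suc (suc y)
    run (projᶜ i) t x xs = suc (lookup xs i)
    run (queryᶜ _) t x (i ∷ []) = entry t x i
    run (compᶜ f gs) t x xs = ifz (product (run* gs t x xs)) 0 (run f t x (map pred (run* gs t x xs)))
    run (precᶜ f g) t x (k ∷ xs) = rec (run f t x xs) (λ i a → ifz a 0 (run g t x (i ∷ pred a ∷ xs))) k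
    -- `pred` merges both failures of `search`, 0 and 1, into "undefined", and turns `suc (suc k)`
    -- into the code of the result `k`.
    run (minᶜ f) t x xs = pred (search (λ i → run f t x (i ∷ xs)) t)

    run* : Vec (Code ⊤ n) m → ℕ → ℕ → Vec ℕ n → Vec ℕ m
    run* []       t x xs = []
    run* (g ∷ gs) t x xs = run g t x xs ∷ run* gs t x xs

  mutual
    -- By recursion on the program: each Γ gets an evaluator of its own, which spares a universal
    -- machine.
    runᴿ : Code ⊤ n → Rec (2 + n)
    runᴿ zeroᶜ        = lit 1
    runᴿ sucᶜ         = succ (succ (var 2F))
    runᴿ (projᶜ i)    = succ (var (suc (suc i)))
    runᴿ (queryᶜ _)   = entryᴿ (var 0F) (var 1F) (var 2F)
    runᴿ (compᶜ f gs) = ifzᴿ (productᴿ (runᴿ* gs)) (lit 0) (comp (runᴿ f) (var 0F ∷ var 1F ∷ predᴿ* (runᴿ* gs)))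
    runᴿ (precᶜ f g)  = natrec (comp (runᴿ f) (var 0F ∷ var 1F ∷ rest 3))
      (ifzᴿ (var 1F) (lit 0) (comp (runᴿ g) (var 2F ∷ var 3F ∷ var 0F ∷ predᴿ (var 1F) ∷ rest 5))) (var 2F)
    runᴿ (minᶜ f)     = predᴿ (natrec (lit 0)
      (ifzᴿ (var 1F) (ifzᴿ v (lit 1) (ifzᴿ (predᴿ v) (succ (succ (var 0F))) (lit 0))) (var 1F)) (var 0F))
      where v = comp (runᴿ f) (var 2F ∷ var 3F ∷ var 0F ∷ rest 4)

    runᴿ* : Vec (Code ⊤ n) m → Vec (Rec (2 + n)) m
    runᴿ* []       = []
    runᴿ* (g ∷ gs) = runᴿ g ∷ runᴿ* gs

    ⟦runᴿ⟧ : (e : Code ⊤ n) → ∀ t x xs → ⟦ runᴿ e ⟧ (t ∷ x ∷ xs) ≡ run e t x xs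
    ⟦runᴿ⟧ zeroᶜ t x xs = refl
    ⟦runᴿ⟧ sucᶜ t x (y ∷ []) = refl
    ⟦runᴿ⟧ (projᶜ i) t x xs = refl
    ⟦runᴿ⟧ (queryᶜ o) t x (i ∷ []) = refl
    ⟦runᴿ⟧ (compᶜ f gs) t x xs
      rewrite ⟦productᴿ⟧ (runᴿ* gs) (t ∷ x ∷ xs) | ⟦predᴿ*⟧ (runᴿ* gs) (t ∷ x ∷ xs) | ⟦runᴿ*⟧ gs t x xs =
      cong (ifz (product (run* gs t x xs)) 0) (⟦runᴿ⟧ f t x _)
    ⟦runᴿ⟧ (precᶜ f g) t x (k ∷ xs)
      rewrite ⟦rest⟧ (t ∷ x ∷ k ∷ []) xs | ⟦runᴿ⟧ f t x xs =
      rec-cong (run f t x xs) (λ i a → cong (ifz a 0) (trans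
        (cong (λ ys → ⟦ runᴿ g ⟧ (t ∷ x ∷ i ∷ pred a ∷ ys)) (⟦rest⟧ (i ∷ a ∷ t ∷ x ∷ k ∷ []) xs))
        (⟦runᴿ⟧ g t x (i ∷ pred a ∷ xs)))) k
    ⟦runᴿ⟧ (minᶜ f) t x xs = cong pred (rec-cong 0 (λ i a →
      cong (λ v → ifz a (ifz v 1 (ifz (pred v) (suc (suc i)) 0)) a) (trans
        (cong (λ ys → ⟦ runᴿ f ⟧ (t ∷ x ∷ i ∷ ys)) (⟦rest⟧ (i ∷ a ∷ t ∷ x ∷ []) xs))
        (⟦runᴿ⟧ f t x (i ∷ xs)))) t)

    ⟦runᴿ*⟧ : (gs : Vec (Code ⊤ n) m) → ∀ t x xs → ⟦ runᴿ* gs ⟧* (t ∷ x ∷ xs) ≡ run* gs t x xs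
    ⟦runᴿ*⟧ []       t x xs = refl
    ⟦runᴿ*⟧ (g ∷ gs) t x xs = cong₂ _∷_ (⟦runᴿ⟧ g t x xs) (⟦runᴿ*⟧ gs t x xs)

  map-pred-suc : (ys : Vec ℕ m) → map pred (map suc ys) ≡ ys
  map-pred-suc []       = refl
  map-pred-suc (y ∷ ys) = cong (y ∷_) (map-pred-suc ys)

  search-zero : ∀ v t → search v t ≡ 0 → ∀ i → i < t → ∃[ y ] (v i ≡ suc (suc y))
  search-zero v (suc t) eq i i<1+t with search v t in eq′
  ... | zero with v t in eq″
  ...   | suc (suc y) with m<1+n⇒m<n∨m≡n i<1+t
  ...     | inj₁ i<t  = search-zero v t eq′ i i<t
  ...     | inj₂ refl = y , eq″

  search-sound : ∀ v t k → search v t ≡ suc (suc k) →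
                 v k ≡ 1 × (∀ i → i < k → ∃[ y ] (v i ≡ suc (suc y)))
  search-sound v (suc t) k eq with search v t in eq′
  ... | suc a = search-sound v t k (trans eq′ eq)
  ... | zero with v t in eq″
  ...   | suc zero with refl ← eq = eq″ , search-zero v t eq′

  search-below : ∀ v k → (∀ i → i < k → ∃[ y ] (v i ≡ suc (suc y))) → search v k ≡ 0
  search-below v zero    pos = refl
  search-below v (suc k) pos
    rewrite search-below v k (λ i i<k → pos i (m<n⇒m<1+n i<k)) | proj₂ (pos k ≤-refl) = refl

  search-complete : ∀ v k {t} → v k ≡ 1 → (∀ i → i < k → ∃[ y ] (v i ≡ suc (suc y))) → k < t →
                    search v t ≡ suc (suc k)
  search-complete v k {t} vk≡1 pos k<t = go (≤⇒≤′ k<t)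
    where
    go : ∀ {t} → suc k ≤′ t → search v t ≡ suc (suc k)
    go ≤′-refl rewrite search-below v k pos | vk≡1 = refl
    go (≤′-step k<t) rewrite go k<t = refl

  product-pos : (ys : Vec ℕ m) → product (map suc ys) ≢ 0
  product-pos (y ∷ ys) eq with m*n≡0⇒m≡0∨n≡0 (suc y) {product (map suc ys)} eq
  ... | inj₂ p = product-pos ys p

  module _ {φ : ⊤ → ℕ → ℕ} {t x : ℕ} (agrees : ∀ i y → entry t x i ≡ suc y → φ tt i ≡ y) where
    mutual
      run-sound : ∀ (e : Code ⊤ n) xs y → run e t x xs ≡ suc y → φ ⊢ e · xs ⇓ y
      run-sound zeroᶜ [] y refl = zero⇓
      run-sound sucᶜ (z ∷ []) y refl = suc⇓
      run-sound (projᶜ i) xs y refl = proj⇓ i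
      run-sound (queryᶜ tt) (i ∷ []) y eq with refl ← agrees i y eq = query⇓ tt
      run-sound (compᶜ f gs) xs y eq with product (run* gs t x xs) in eq′
      ... | suc _ = comp⇓ (run-sound* gs xs (λ ≡0 → contradiction (trans (sym eq′) ≡0) 1+n≢0)) (run-sound f _ y eq)
      run-sound (precᶜ f g) (k ∷ xs) y eq = run-sound-prec f g k xs y eq
      run-sound (minᶜ f) xs y eq = run-sound-min f xs y _ refl eq

      run-sound-prec : ∀ (f : Code ⊤ n) g k xs y → run (precᶜ f g) t x (k ∷ xs) ≡ suc y →
                       φ ⊢ precᶜ f g · (k ∷ xs) ⇓ y
      run-sound-prec f g zero    xs y eq = prec0⇓ (run-sound f xs y eq)
      run-sound-prec f g (suc k) xs y eq with run (precᶜ f g) t x (k ∷ xs) in eq′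
      ... | suc a = precs⇓ (run-sound-prec f g k xs a eq′) (run-sound g (k ∷ a ∷ xs) y eq)

      run-sound-min : ∀ (f : Code ⊤ (suc n)) xs y s → search (λ i → run f t x (i ∷ xs)) t ≡ s →
                      pred s ≡ suc y → φ ⊢ minᶜ f · xs ⇓ y
      run-sound-min f xs y (suc (suc .y)) eq refl = min⇓
        (λ i i<y → let z , p = proj₂ found i i<y in z , run-sound f (i ∷ xs) (suc z) p)
        (run-sound f (y ∷ xs) 0 (proj₁ found))
        where found = search-sound (λ i → run f t x (i ∷ xs)) t y eq

      run-sound* : ∀ (gs : Vec (Code ⊤ n) m) xs → product (run* gs t x xs) ≢ 0 →
                   Pointwise (λ g y → φ ⊢ g · xs ⇓ y) gs (map pred (run* gs t x xs))
      run-sound* [] xs _ = []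
      run-sound* (g ∷ gs) xs ≢0 with run g t x xs in eq
      ... | zero  = contradiction refl ≢0
      ... | suc y = run-sound g xs y eq ∷
                    run-sound* gs xs (λ ≡0 → ≢0 (trans (cong (suc y *_) ≡0) (*-zeroʳ (suc y))))

  -- Finitely many witnesses can be replaced by their maximum, because `Q` is monotone in the
  -- witness.
  bounded-choice : ∀ n (P : ℕ → Set) (Q : ℕ → ℕ → Set) → (∀ i → Dec (P i)) →
                   (∀ {i b c} → b ≤ c → Q i b → Q i c) →
                   (∀ i → i < n → P i → ∃[ b ] Q i b) → ∃[ b ] (∀ i → i < n → P i → Q i b)
  bounded-choice zero    P Q P? mono pick = 0 , λ _ ()
  bounded-choice (suc n) P Q P? mono pick
    with bounded-choice n P Q P? mono (λ i i<n → pick i (m<n⇒m<1+n i<n)) | P? n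
  ... | b , below | no ¬p = b , λ i i<1+n p →
    [ (λ i<n → below i i<n p) , (λ { refl → contradiction p ¬p }) ]′ (m<1+n⇒m<n∨m≡n i<1+n)
  ... | b , below | yes p with c , q ← pick n ≤-refl p = b ⊔ c , λ i i<1+n p →
    [ (λ i<n → mono (m≤m⊔n b c) (below i i<n p)) , (λ { refl → mono (m≤n⊔m b c) q }) ]′ (m<1+n⇒m<n∨m≡n i<1+n)

  -- The use principle with one number `b` for both the use and the time: the length of the finite
  -- oracle is also the time bound.
  record Settles (Y : ℕ → ℕ) (e : Code ⊤ n) (xs : Vec ℕ n) (y b : ℕ) : Set where
    constructor settles
    field
      settled : ∀ t x → b ≤ t → (∀ i → i < b → entry t x i ≡ suc (Y i)) → run e t x xs ≡ suc y
  open Settles public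

  module _ {Y : ℕ → ℕ} where
    private
      infix 4 _·_⇓ʸ_
      _·_⇓ʸ_ : Code ⊤ n → Vec ℕ n → ℕ → Set
      e · xs ⇓ʸ y = (λ (_ : ⊤) → Y) ⊢ e · xs ⇓ y

    settles-mono : ∀ {e : Code ⊤ n} {xs y b c} → b ≤ c → Settles Y e xs y b → Settles Y e xs y c
    settles-mono b≤c (settles p) =
      settles λ t x c≤t agrees → p t x (≤-trans b≤c c≤t) (λ i i<b → agrees i (<-≤-trans i<b b≤c))

    mutual
      run-complete : ∀ {e : Code ⊤ n} {xs y} → e · xs ⇓ʸ y → ∃[ b ] Settles Y e xs y b
      run-complete zero⇓ = 0 , settles λ _ _ _ _ → refl
      run-complete suc⇓  = 0 , settles λ _ _ _ _ → refl
      run-complete (proj⇓ i) = 0 , settles λ _ _ _ _ → refl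
      run-complete (query⇓ {x = i} _) = suc i , settles λ _ _ _ agrees → agrees i ≤-refl
      run-complete (comp⇓ {f = f} {gs} {xs} {ys} {z} ps p) with run-complete* ps | run-complete p
      ... | b , q* | c , q = b ⊔ c , settles result
        where
        result : ∀ t x → b ⊔ c ≤ t → (∀ i → i < b ⊔ c → entry t x i ≡ suc (Y i)) →
                 run (compᶜ f gs) t x xs ≡ suc z
        result t x b≤t agrees
          rewrite q* t x (m⊔n≤o⇒m≤o b c b≤t) (λ i i<b → agrees i (<-≤-trans i<b (m≤m⊔n b c)))
                | map-pred-suc ys
          with product (map suc ys) in eq
        ... | zero  = contradiction eq (product-pos ys)
        ... | suc _ = settled (settles-mono (m≤n⊔m b c) q) t x b≤t agrees
      run-complete (prec0⇓ p) with b , settles q ← run-complete p = b , settles q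
      run-complete (precs⇓ {f = f} {g} {xs} {k} {y} {z} p p′) with run-complete p | run-complete p′
      ... | b , q | c , q′ = b ⊔ c , settles result
        where
        result : ∀ t x → b ⊔ c ≤ t → (∀ i → i < b ⊔ c → entry t x i ≡ suc (Y i)) →
                 run (precᶜ f g) t x (suc k ∷ xs) ≡ suc z
        result t x b≤t agrees rewrite settled (settles-mono (m≤m⊔n b c) q) t x b≤t agrees =
          settled (settles-mono (m≤n⊔m b c) q′) t x b≤t agrees
      run-complete (min⇓ {f = f} {xs} {k} p p₀)
        with c , q ← run-complete p₀
           | b , qs ← bounded-choice k (λ _ → ⊤) (λ i b → ∃[ y ] Settles Y f (i ∷ xs) (suc y) b)
                        (λ _ → yes tt) (λ b≤c (y , q) → y , settles-mono b≤c q)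
                        (λ i i<k _ → let b , q = run-complete (proj₂ (p i i<k)) in b , proj₁ (p i i<k) , q) =
        -- `search` inspects only places below `t`, so the zero at `k` is found only when `k < t`.
        suc k ⊔ (b ⊔ c) , settles λ t x b≤t agrees →
          cong pred (search-complete (λ i → run f t x (i ∷ xs)) k
            (settled (settles-mono (≤-trans (m≤n⊔m b c) (m≤n⊔m (suc k) (b ⊔ c))) q) t x b≤t agrees)
            (λ i i<k → let y , q = qs i i<k tt in
              y , settled (settles-mono (≤-trans (m≤m⊔n b c) (m≤n⊔m (suc k) (b ⊔ c))) q) t x b≤t agrees)
            (m⊔n≤o⇒m≤o (suc k) (b ⊔ c) b≤t))

      run-complete* : ∀ {gs : Vec (Code ⊤ n) m} {xs ys} → Pointwise (λ g y → g · xs ⇓ʸ y) gs ys →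
                      ∃[ b ] (∀ t x → b ≤ t → (∀ i → i < b → entry t x i ≡ suc (Y i)) →
                              run* gs t x xs ≡ map suc ys)
      run-complete* [] = 0 , λ _ _ _ _ → refl
      run-complete* (p ∷ ps) with run-complete p | run-complete* ps
      ... | b , q | c , q* = b ⊔ c , λ t x b≤t agrees → cong₂ _∷_
        (settled (settles-mono (m≤m⊔n b c) q) t x b≤t agrees)
        (q* t x (m⊔n≤o⇒n≤o b c b≤t) (λ i i<c → agrees i (<-≤-trans i<c (m≤n⊔m b c))))

-- Bushy trees and the combinatorics of bigness

module BushyTrees where

  open import Data.Nat
  open import Data.Nat.Properties
  open Recursive
  open Pairing
  open Bound
  open OracleRuns

  -- A list is read as a finite sequence with its last entry at the head.

  index : List ℕ → ℕ
  index []      = 0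
  index (i ∷ τ) = pair (index τ) i

  _‼_ : List ℕ → ℕ → ℕ
  []      ‼ i = 0
  (b ∷ τ) ‼ i with i ≟ length τ
  ... | yes _ = b
  ... | no _  = τ ‼ i

  entry-index : ∀ τ i → i < length τ → entry (length τ) (index τ) i ≡ suc (τ ‼ i)
  entry-index τ i i<∣τ∣ with length τ ∸ i in eq
  ... | zero  = contradiction (m∸n≡0⇒m≤n eq) (<⇒≱ i<∣τ∣)
  ... | suc _ = cong suc (go τ i<∣τ∣)
    where
    peel : ∀ x k → rec x (λ _ → π₁) (suc k) ≡ rec (π₁ x) (λ _ → π₁) k
    peel x zero    = refl
    peel x (suc k) = cong π₁ (peel x k)
    go : ∀ τ → i < length τ → π₂ (rec (index τ) (λ _ → π₁) (length τ ∸ suc i)) ≡ τ ‼ i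
    go (b ∷ τ) i<1+n with i ≟ length τ
    ... | yes refl rewrite n∸n≡0 i = π₂-pair (index τ) b
    ... | no i≢n = begin
      π₂ (rec x (λ _ → π₁) (n ∸ i))            ≡⟨ cong (λ k → π₂ (rec x (λ _ → π₁) k)) (+-∸-assoc 1 i<n) ⟩
      π₂ (rec x (λ _ → π₁) (suc (n ∸ suc i)))  ≡⟨ cong π₂ (peel x (n ∸ suc i)) ⟩
      π₂ (rec (π₁ x) (λ _ → π₁) (n ∸ suc i))
        ≡⟨ cong (λ z → π₂ (rec z (λ _ → π₁) (n ∸ suc i))) (π₁-pair (index τ) b) ⟩
      π₂ (rec (index τ) (λ _ → π₁) (n ∸ suc i)) ≡⟨ go τ i<n ⟩
      τ ‼ i                                    ∎
      where
      open ≡-Reasoning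
      n = length τ
      x = index (b ∷ τ)
      i<n = ≤∧≢⇒< (s≤s⁻¹ i<1+n) i≢n

  data Bounded : List ℕ → Set where
    []  : Bounded []
    _∷_ : ∀ {i τ} → i < bound (length τ) → Bounded τ → Bounded (i ∷ τ)

  index<stringBound : ∀ {τ t b} → Bounded τ → length τ ≤ t → (∀ i → i < length τ → bound i ≤ b) →
                      index τ < stringBound t b
  index<stringBound {t = t} {b} [] _ _ = stringBound-mono {0} {b} {t} {b} z≤n ≤-refl
  index<stringBound (i< ∷ p) (s≤s ≤t) ≤b = pair-strict
    (index<stringBound p ≤t (λ i i< → ≤b i (m<n⇒m<1+n i<))) (<-≤-trans i< (≤b _ ≤-refl))

  data Ext : ℕ → List ℕ → List ℕ → Set where
    done : ∀ {σ} → Ext 0 σ σ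
    step : ∀ {m i σ τ} → i < bound (length σ) → Ext m (i ∷ σ) τ → Ext (suc m) σ τ

  ext-length : ∀ {m σ τ} → Ext m σ τ → length τ ≡ m + length σ
  ext-length done = refl
  ext-length {suc m} {σ} (step _ e) = trans (ext-length e) (+-suc m (length σ))

  ext-bounded : ∀ {m σ τ} → Ext m σ τ → Bounded σ → Bounded τ
  ext-bounded done        p = p
  ext-bounded (step i< e) p = ext-bounded e (i< ∷ p)

  ext-≤ : ∀ {m σ τ} → Ext m σ τ → length σ ≤ length τ
  ext-≤ {m} {σ} e = ≤-trans (m≤n+m (length σ) m) (≤-reflexive (sym (ext-length e)))

  ind : {P : Set} → Dec P → ℕ
  ind (yes _) = 1
  ind (no _)  = 0

  ind-mono : {P Q : Set} (p? : Dec P) (q? : Dec Q) → (P → Q) → ind p? ≤ ind q?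
  ind-mono (yes p) (yes q) _   = ≤-refl
  ind-mono (yes p) (no ¬q) p→q = contradiction (p→q p) ¬q
  ind-mono (no _)  _       _   = z≤n

  ind-∪ : {P Q R : Set} (r? : Dec R) (p? : Dec P) (q? : Dec Q) → (R → P ⊎ Q) → ind r? ≤ ind p? + ind q?
  ind-∪ r? (yes p) q? _     = ≤-trans (ind-mono r? (yes tt) _) (m≤m+n 1 (ind q?))
  ind-∪ r? (no ¬p) q? split = ind-mono r? q? (λ r → [ (λ p → contradiction p ¬p) , id ]′ (split r))

  ind-≤ : ∀ {P} h c (p? : Dec P) → (P → h ≤ c) → (h ≤ c → P) → 1 ∸ (h ∸ c) ≡ ind p?
  ind-≤ h c (yes p) to _ = cong (1 ∸_) (m≤n⇒m∸n≡0 (to p))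
  ind-≤ h c (no ¬p) _ from = m≤n⇒m∸n≡0 (m<n⇒0<n∸m (≰⇒> (¬p ∘ from)))

  ind-eq : ∀ {P} x y (p? : Dec P) → (P → x ≡ y) → (x ≡ y → P) → eq x y ≡ ind p?
  ind-eq x y (yes p) to _ = trans (cong (eq x) (sym (to p))) (eq-refl x)
  ind-eq x y (no ¬p) _ from = eq-≢ (¬p ∘ from)

  Σ<-mono : ∀ n {f g} → (∀ i → i < n → f i ≤ g i) → Σ< n f ≤ Σ< n g
  Σ<-mono zero    f≤g = z≤n
  Σ<-mono (suc n) f≤g = +-mono-≤ (Σ<-mono n (λ i i<n → f≤g i (m<n⇒m<1+n i<n))) (f≤g n ≤-refl)

  Σ<-cong : ∀ n {f g} → (∀ i → i < n → f i ≡ g i) → Σ< n f ≡ Σ< n g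
  Σ<-cong n f≡g = ≤-antisym (Σ<-mono n (λ i i<n → ≤-reflexive (f≡g i i<n)))
                            (Σ<-mono n (λ i i<n → ≤-reflexive (sym (f≡g i i<n))))

  Σ<-+ : ∀ n f g → Σ< n (λ i → f i + g i) ≡ Σ< n f + Σ< n g
  Σ<-+ zero    f g = refl
  Σ<-+ (suc n) f g rewrite Σ<-+ n f g = ring (Σ< n f) (Σ< n g) (f n) (g n)
    where
    open import Data.Nat.Tactic.RingSolver using (solve-∀)
    ring : ∀ a b c d → a + b + (c + d) ≡ a + c + (b + d)
    ring = solve-∀

  -- Bigness computed from the leaves downwards: `c` marks the leaves at length `t`, and after `m`
  -- rounds digit `x` says whether the string of length `t ∸ m` with index `x` is `h`-big. The term
  -- `1 ∸ (h ∸ s)` is the truth value of `h ≤ s`.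
  levels : ℕ → (ℕ → ℕ) → ℕ → ℕ → ℕ → ℕ
  levels h c N t = rec (table N c) λ i T →
    table N (λ x → 1 ∸ (h ∸ Σ< (bound (t ∸ suc i)) (λ j → bit T (pair x j))))

  module Bushy (em : ExcludedMiddle 0ℓ) where

    count : ℕ → (ℕ → Set) → ℕ
    count n P = Σ< n (λ i → ind (em {P i}))

    count-mono : ∀ n {P Q : ℕ → Set} → (∀ i → i < n → P i → Q i) → count n P ≤ count n Q
    count-mono n P⊆Q = Σ<-mono n (λ i i<n → ind-mono em em (P⊆Q i i<n))

    count-∪ : ∀ n {P Q R : ℕ → Set} → (∀ i → R i → P i ⊎ Q i) → count n R ≤ count n P + count n Q
    count-∪ n {P} {Q} split = ≤-trans (Σ<-mono n (λ i _ → ind-∪ em em em (split i)))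
      (≤-reflexive (Σ<-+ n (λ i → ind (em {P i})) (λ i → ind (em {Q i}))))

    count-all : ∀ n {P : ℕ → Set} → (∀ i → i < n → P i) → n ≤ count n P
    count-all zero    all = z≤n
    count-all (suc n) all = ≤-trans (≤-reflexive (+-comm 1 n))
      (+-mono-≤ (count-all n (λ i i<n → all i (m<n⇒m<1+n i<n))) (ind-mono (yes tt) em (λ _ → all n ≤-refl)))

    count-unique : ∀ n {P : ℕ → Set} → (∀ {i j} → P i → P j → i ≡ j) → count n P ≤ 1
    count-unique zero            unique = z≤n
    count-unique (suc n) {P} unique with em {P n}
    ... | no ¬p = ≤-trans (≤-reflexive (+-identityʳ _)) (count-unique n unique)
    ... | yes p = ≤-reflexive (cong (_+ 1) (Σ<-zero n λ i i<n →
      n<1⇒n≡0 (s≤s (ind-mono em (no id) (λ q → <⇒≢ i<n (unique q p))))))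

    -- Some h-branching tree above τ has all its leaves, m levels up, in A.
    Big : ℕ → Pred (List ℕ) 0ℓ → ℕ → Pred (List ℕ) 0ℓ
    Big h A zero    τ = A τ
    Big h A (suc m) τ = h ≤ count (bound (length τ)) (λ i → Big h A m (i ∷ τ))

    Small : ℕ → Pred (List ℕ) 0ℓ → Pred (List ℕ) 0ℓ
    Small h B σ = ∀ m → ¬ Big h B m σ

    Closed : Pred (List ℕ) 0ℓ → Set
    Closed B = ∀ {i τ} → i < bound (length τ) → B τ → B (i ∷ τ)

    big-mono : ∀ {h k A B} m {σ} → k ≤ h → A ⊆ B → Big h A m σ → Big k B m σ
    big-mono zero    k≤h A⊆B a   = A⊆B a
    big-mono (suc m) {σ} k≤h A⊆B big =
      ≤-trans k≤h (≤-trans big (count-mono (bound (length σ)) (λ i _ → big-mono m k≤h A⊆B)))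

    -- If both failed, fewer than `h` children would be big for `A` and fewer than `k` for `B`; but
    -- by induction each of the `h + k` big children is counted on one of the two sides.
    big-∪ : ∀ {h k A B} m {σ} → Big (h + k) (A ∪ B) m σ → Big h A m σ ⊎ Big k B m σ
    big-∪ zero big = big
    big-∪ {h} {k} {A} {B} (suc m) {σ} big
      with h ≤? count (bound (length σ)) (λ i → Big h A m (i ∷ σ))
         | k ≤? count (bound (length σ)) (λ i → Big k B m (i ∷ σ))
    ... | yes p | _     = inj₁ p
    ... | no _  | yes q = inj₂ q
    ... | no p  | no q  = contradiction
      (≤-trans big (count-∪ (bound (length σ)) (λ i → big-∪ {h} {k} {A} {B} m)))
      (<⇒≱ (+-mono-< (≰⇒> p) (≰⇒> q)))

    -- One colour is split off at a time: `suc (suc c) * h` is `h + suc c * h`, and `big-∪` applies.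
    big-pigeonhole : ∀ {h} (A : ℕ → Pred (List ℕ) 0ℓ) c m {σ} →
                     Big (suc c * h) (λ τ → ∃[ y ] (y < suc c × A y τ)) m σ → ∃[ y ] Big h (A y) m σ
    big-pigeonhole {h} A zero m big = 0 ,
      big-mono m (≤-reflexive (sym (*-identityˡ h))) (λ { (zero , _ , a) → a ; (suc _ , s≤s () , _) }) big
    big-pigeonhole {h} A (suc c) m big with big-∪ {h} {suc c * h} m (big-mono m ≤-refl split big)
      where
      split : (λ τ → ∃[ y ] (y < suc (suc c) × A y τ)) ⊆ A (suc c) ∪ (λ τ → ∃[ y ] (y < suc c × A y τ))
      split (y , y< , a) with m<1+n⇒m<n∨m≡n y<
      ... | inj₁ y<  = inj₂ (y , y< , a)
      ... | inj₂ refl = inj₁ a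
    ... | inj₁ p = suc c , p
    ... | inj₂ p = big-pigeonhole A c m p

    small-mono : ∀ {h k B σ} → h ≤ k → Small h B σ → Small k B σ
    small-mono h≤k small m big = small m (big-mono m h≤k id big)

    big-full : ∀ {h A} m {σ} → h ≤ bound (length σ) → (∀ {τ} → Ext m σ τ → A τ) → Big h A m σ
    big-full zero    _   all = all done
    big-full (suc m) {σ} h≤b all = ≤-trans h≤b (count-all (bound (length σ)) (λ i i< →
      big-full m (≤-trans h≤b (bound-mono (n≤1+n _))) (λ e → all (step i< e))))

    -- Above a leaf in a closed set all strings are again in it, and there are enough of them
    -- because the bound does not decrease.
    big-extend : ∀ {h B m n σ} → Closed B → h ≤ bound (length σ) → m ≤ n → Big h B m σ → Big h B n σ
    big-extend {h} {B} closed h≤b m≤n = go (≤⇒≤′ m≤n) h≤b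
      where
      one : ∀ m {σ} → h ≤ bound (length σ) → Big h B m σ → Big h B (suc m) σ
      one zero    {σ} h≤b b   = ≤-trans h≤b (count-all (bound (length σ)) (λ i i< → closed i< b))
      one (suc m) {σ} h≤b big = ≤-trans big (count-mono (bound (length σ)) λ i _ →
        one m (≤-trans h≤b (bound-mono (n≤1+n (length σ)))))
      go : ∀ {m n σ} → m ≤′ n → h ≤ bound (length σ) → Big h B m σ → Big h B n σ
      go ≤′-refl       h≤b big = big
      go {σ = σ} (≤′-step {n} m≤n) h≤b big = one n {σ} h≤b (go m≤n h≤b big)

    -- Climb through children that are big for `A` and small for `B`. If there were none, every
    -- child big for `A` would be big for `B` at some height; with a common height for these
    -- finitely many children, `σ` itself would be big for `B`.
    escape : ∀ {h A B} m {σ} → Closed B → h ≤ bound (length σ) → Big h A m σ → Small h B σ →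
             ∃[ τ ] (Ext m σ τ × A τ × Small h B τ)
    escape zero {σ} closed h≤b a small = σ , done , a , small
    escape {h} {A} {B} (suc m) {σ} closed h≤b big small
      with em {∃[ i ] (i < bound (length σ) × Big h A m (i ∷ σ) × Small h B (i ∷ σ))}
    ... | yes (i , i< , big′ , small′)
      with τ , e , a , s ← escape m closed (≤-trans h≤b (bound-mono (n≤1+n _))) big′ small′ =
      τ , step i< e , a , s
    ... | no none = contradiction (≤-trans big (count-mono (bound (length σ)) all-big)) (small (suc N))
      where
      P : ℕ → Set
      P i = Big h A m (i ∷ σ)
      collected : ∃[ n ] (∀ i → i < bound (length σ) → P i → Big h B n (i ∷ σ))
      collected = bounded-choice (bound (length σ)) P (λ i n → Big h B n (i ∷ σ)) (λ _ → em)
        (λ {i} → big-extend {σ = i ∷ σ} closed (≤-trans h≤b (bound-mono (n≤1+n _))))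
        λ i i< p → case-em i i< p
        where
        case-em : ∀ i → i < bound (length σ) → P i → ∃[ n ] Big h B n (i ∷ σ)
        case-em i i< p with em {∃[ n ] Big h B n (i ∷ σ)}
        ... | yes q = q
        ... | no ¬q = contradiction (i , i< , p , λ n b → ¬q (n , b)) none
      N = proj₁ collected
      all-big = proj₂ collected

    -- The leaves settle at different lengths. Beyond the maximum, full branching above each leaf
    -- brings the whole tree to one level, where membership in `E` replaces the unbounded property
    -- `A`.
    big-uniform : ∀ {h A} {E : ℕ → Pred (List ℕ) 0ℓ} →
                  (∀ {τ} → A τ → ∃[ b ] (∀ {m τ′} → Ext m τ τ′ → b ≤ length τ′ → E (length τ′) τ′)) →
                  ∀ m {σ} → h ≤ bound (length σ) → Big h A m σ →
                  ∃[ b ] (∀ n → b ≤ n → Big h (E (n + length σ)) n σ)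
    big-uniform {E = E} limit zero {σ} h≤b a with b , p ← limit a = b , λ n b≤n →
      big-full n h≤b λ {τ} e → let q = ext-length e in
        subst (λ l → E l τ) q (p e (≤-trans b≤n (≤-trans (m≤m+n n (length σ)) (≤-reflexive (sym q)))))
    big-uniform {h} {A} {E} limit (suc m) {σ} h≤b big
      with b , p ← bounded-choice (bound (length σ)) (λ i → Big h A m (i ∷ σ))
                     (λ i b → ∀ n → b ≤ n → Big h (E (n + suc (length σ))) n (i ∷ σ)) (λ _ → em)
                     (λ b≤c p n c≤n → p n (≤-trans b≤c c≤n))
                     (λ i _ → big-uniform {E = E} limit m (≤-trans h≤b (bound-mono (n≤1+n _)))) =
      suc b , λ { (suc n) (s≤s b≤n) → ≤-trans big (count-mono (bound (length σ)) λ i i< big′ →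
        subst (λ l → Big h (E l) n (i ∷ σ)) (+-suc n (length σ)) (p i i< big′ n b≤n)) }

    -- Correctness of `levels`. The number `N` exceeds the index of every bounded string of length
    -- at most `t`, so no digit is read outside the tables.
    bit-levels : ∀ {h c t A} → let N = stringBound t (bound t) in (∀ x → c x ≤ 1) →
                 (∀ {τ} → length τ ≡ t → c (index τ) ≡ ind (em {A τ})) →
                 ∀ m {τ} → Bounded τ → m + length τ ≡ t →
                 bit (levels h c N t m) (index τ) ≡ ind (em {Big h A m τ})
    bit-levels {h} {c} {t} {A} c≤1 decides m {τ} bounded eq = go m bounded eq
      where
      N = stringBound t (bound t)
      index<N : ∀ {τ} → Bounded τ → length τ ≤ t → index τ < N
      index<N p ≤t = index<stringBound p ≤t (λ i i< → bound-mono (≤-trans (<⇒≤ i<) ≤t))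
      go : ∀ m {τ} → Bounded τ → m + length τ ≡ t →
           bit (levels h c N t m) (index τ) ≡ ind (em {Big h A m τ})
      go zero p eq = trans (bit-table N c c≤1 _ (index<N p (≤-reflexive eq))) (decides eq)
      go (suc m) {τ} p eq = begin
        bit (levels h c N t (suc m)) (index τ)
          ≡⟨ bit-table N below (λ x → m∸n≤m 1 (h ∸ Σ< (bound (t ∸ suc m)) (λ j → bit T (pair x j)))) (index τ)
               (index<N p (≤-trans (m≤n+m _ (suc m)) (≤-reflexive eq))) ⟩
        1 ∸ (h ∸ Σ< (bound (t ∸ suc m)) (λ j → bit T (pair (index τ) j)))
          ≡⟨ cong (λ l → 1 ∸ (h ∸ Σ< (bound l) (λ j → bit T (pair (index τ) j)))) ∣τ∣ ⟩
        1 ∸ (h ∸ Σ< (bound (length τ)) (λ j → bit T (pair (index τ) j)))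
          ≡⟨ cong (λ s → 1 ∸ (h ∸ s)) (Σ<-cong (bound (length τ)) λ j j< →
               go m (j< ∷ p) (trans (+-suc m (length τ)) eq)) ⟩
        1 ∸ (h ∸ count (bound (length τ)) (λ j → Big h A m (j ∷ τ)))
          ≡⟨ ind-≤ h _ em id id ⟩
        ind (em {Big h A (suc m) τ}) ∎
        where
        open ≡-Reasoning
        T = levels h c N t m
        below : ℕ → ℕ
        below x = 1 ∸ (h ∸ Σ< (bound (t ∸ suc m)) (λ j → bit T (pair x j)))
        ∣τ∣ : t ∸ suc m ≡ length τ
        ∣τ∣ = trans (cong (_∸ suc m) (sym eq)) (m+n∸m≡n (suc m) (length τ))

-- The guessing program and forcing with bushy trees

module Genericity where

  open import Data.Nat
  open import Data.Nat.Properties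
  open Recursive
  open Pairing
  open Bound
  open OracleRuns
  open BushyTrees

  private variable
    n : ℕ

  executeᴿ : Code ⊤ n → Rec (2 + n)
  executeᴿ e = named (λ xs → run e (head xs) (head (tail xs)) (tail (tail xs))) (runᴿ e)
    λ { (t ∷ x ∷ xs) → ⟦runᴿ⟧ e t x xs }

  -- A trial w = pair y b looks for an a-branching tree, reaching up to level w + a, on whose
  -- leaves Γ outputs y.
  trial : Code ⊤ 1 → ℕ → ℕ → ℕ
  trial Γ w a = levels a (λ x → eq (run Γ t x (point a ∷ [])) (suc (π₁ w))) (stringBound t (bound t)) t w
    where t = w + a

  least-zero : ∀ w (f : ℕ → ℕ) → f w ≡ 0 → ∃[ k ] (f k ≡ 0 × (∀ i → i < k → ∃[ y ] (f i ≡ suc y)))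
  least-zero w f p with f 0 in eq
  least-zero w       f p | zero  = 0 , eq , λ _ ()
  least-zero zero    f p | suc _ = contradiction (trans (sym eq) p) 1+n≢0
  least-zero (suc w) f p | suc y with k , q , pos ← least-zero w (f ∘ suc) p =
    suc k , q , λ { zero _ → y , eq ; (suc i) (s≤s i<k) → pos i i<k }

  opaque
    -- Success is 0 since unbounded search looks for a zero; the input `j` is decoded as a level and
    -- the index of a string of that length.
    verdict : Code ⊤ 1 → ℕ → ℕ → ℕ
    verdict Γ w j = 1 ∸ bit (trial Γ w (π₁ j)) (π₂ j)

    verdict-unfold : ∀ Γ w j → 1 ∸ bit (trial Γ w (π₁ j)) (π₂ j) ≡ verdict Γ w j
    verdict-unfold Γ w j = refl

    verdictᴿ : Code ⊤ 1 → Rec 2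
    verdictᴿ Γ = named (λ xs → verdict Γ (head xs) (head (tail xs)))
      (lit 1 ∸ᴿ bitᴿ (natrec
        (tableᴿ N (eqᴿ (comp (executeᴿ Γ) (wk 1 t ∷ var 0F ∷ pointᴿ (wk 1 a) ∷ [])) (succ (π₁ᴿ (var 1F)))))
        (tableᴿ (wk 2 N) (lit 1 ∸ᴿ (wk 3 a ∸ᴿ
          sumᴿ (boundᴿ (wk 3 t ∸ᴿ succ (var 1F))) (bitᴿ (var 3F) (pairᴿ (var 1F) (var 0F)))))) (var 0F))
        (π₂ᴿ (var 1F)))
      λ { (w ∷ j ∷ []) → refl }
      where
      a t N : Rec 2
      a = π₁ᴿ (var 1F)
      t = var 0F +ᴿ a
      N = stringBoundᴿ t (boundᴿ t)

    ⟦verdictᴿ⟧ : ∀ Γ w j → ⟦ verdictᴿ Γ ⟧ (w ∷ j ∷ []) ≡ verdict Γ w j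
    ⟦verdictᴿ⟧ Γ w j = refl

  opaque
    guess : Code ⊤ 1 → PR 1
    guess Γ = compᶜ (code (π₁ᴿ (var 0F))) (minᶜ (code (verdictᴿ Γ)) ∷ [])

    -- The least successful trial may name another value than the trial `w` known to succeed. What
    -- follows must therefore work with the tree of `v`.
    guess-halts : ∀ Γ j w → verdict Γ w j ≡ 0 → ∃[ v ] (verdict Γ v j ≡ 0 × guess Γ · (j ∷ []) ⇓ π₁ v)
    guess-halts Γ j w p with v , q , pos ← least-zero w (λ w → verdict Γ w j) p = v , q ,
      comp⇓ (min⇓ (λ i i<v → let y , r = pos i i<v in y , halt i r) (halt v q) ∷ []) (halts (π₁ᴿ (var 0F)) (v ∷ []))
      where
      halt : ∀ i {y} → verdict Γ i j ≡ y → code (verdictᴿ Γ) · (i ∷ j ∷ []) ⇓ y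
      halt i r = subst (code (verdictᴿ Γ) · (i ∷ j ∷ []) ⇓_)
        (trans (⟦verdictᴿ⟧ Γ i j) r) (halts (verdictᴿ Γ) (i ∷ j ∷ []))

  _↾_ : (ℕ → ℕ) → ℕ → List ℕ
  Y ↾ zero  = []
  Y ↾ suc n = Y n ∷ Y ↾ n

  length-↾ : ∀ Y n → length (Y ↾ n) ≡ n
  length-↾ Y zero    = refl
  length-↾ Y (suc n) = cong suc (length-↾ Y n)

  ∷-‼ : ∀ b τ i → i < length τ → (b ∷ τ) ‼ i ≡ τ ‼ i
  ∷-‼ b τ i i< with i ≟ length τ
  ... | yes p = contradiction p (<⇒≢ i<)
  ... | no _  = refl

  ext-‼ : ∀ {m σ τ} i → Ext m σ τ → i < length σ → τ ‼ i ≡ σ ‼ i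
  ext-‼ i done _ = refl
  ext-‼ {σ = σ} i (step {i = b} _ e) i< = trans (ext-‼ i e (m<n⇒m<1+n i<)) (∷-‼ b σ i i<)

  head-‼ : ∀ b τ → (b ∷ τ) ‼ length τ ≡ b
  head-‼ b τ with length τ ≟ length τ
  ... | yes _ = refl
  ... | no ≢  = contradiction refl ≢

  ↾-‼ : ∀ Y {n} i → i < n → (Y ↾ n) ‼ i ≡ Y i
  ↾-‼ Y {suc n} i i<1+n with i ≟ length (Y ↾ n)
  ... | yes p = cong Y (sym (trans p (length-↾ Y n)))
  ... | no ≢  = ↾-‼ Y i (≤∧≢⇒< (s≤s⁻¹ i<1+n) (λ p → ≢ (trans p (sym (length-↾ Y n)))))

  ‼-↾ : ∀ {Y} τ → (∀ i → i < length τ → τ ‼ i ≡ Y i) → τ ≡ Y ↾ length τ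
  ‼-↾ []      _     = refl
  ‼-↾ (b ∷ τ) agree = cong₂ _∷_ (trans (sym (head-‼ b τ)) (agree (length τ) ≤-refl))
    (‼-↾ τ (λ i i< → trans (sym (∷-‼ b τ i i<)) (agree i (m<n⇒m<1+n i<))))

  entry-beyond : ∀ {t} x {i} → t ≤ i → entry t x i ≡ 0
  entry-beyond x t≤i rewrite m≤n⇒m∸n≡0 t≤i = refl

  ext-trans : ∀ {m n ρ σ τ} → Ext m ρ σ → Ext n σ τ → ∃[ k ] Ext k ρ τ
  ext-trans done        e′ = _ , e′
  ext-trans (step i< e) e′ with k , e″ ← ext-trans e e′ = suc k , step i< e″

  module Forcing (em : ExcludedMiddle 0ℓ) where
    open Bushy em

    Outputs : Code ⊤ 1 → ℕ → ℕ → ℕ → Pred (List ℕ) 0ℓ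
    Outputs Γ a t y τ = run Γ t (index τ) (point a ∷ []) ≡ suc y

    -- The link between the program and the combinatorics: as `σ` has length `a`, a tree of height
    -- `w` above it has its leaves at level `w + a`.
    verdict-zero : ∀ Γ w {a σ} → length σ ≡ a → Bounded σ →
      (Big a (Outputs Γ a (w + a) (π₁ w)) w σ → verdict Γ w (pair a (index σ)) ≡ 0) ×
      (verdict Γ w (pair a (index σ)) ≡ 0 → Big a (Outputs Γ a (w + a) (π₁ w)) w σ)
    verdict-zero Γ w {a} {σ} ∣σ∣ bounded =
      (λ big → trans verdict≡ (to em big)) , (λ ≡0 → from em (trans (sym verdict≡) ≡0))
      where
      verdict≡ : verdict Γ w (pair a (index σ)) ≡ 1 ∸ ind (em {Big a (Outputs Γ a (w + a) (π₁ w)) w σ})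
      verdict≡ = trans (trans (sym (verdict-unfold Γ w (pair a (index σ))))
        (cong₂ (λ a x → 1 ∸ bit (trial Γ w a) x) (π₁-pair a (index σ)) (π₂-pair a (index σ))))
        (cong (1 ∸_) (bit-levels {a} {A = Outputs Γ a (w + a) (π₁ w)}
          (λ x → m∸n≤m 1 ((run Γ (w + a) x (point a ∷ []) ∸ suc (π₁ w)) +
                          (suc (π₁ w) ∸ run Γ (w + a) x (point a ∷ []))))
          (λ {τ} _ → ind-eq (run Γ (w + a) (index τ) (point a ∷ [])) (suc (π₁ w)) em id id)
          w {σ} bounded (cong (w +_) ∣σ∣)))
      to : ∀ {P} (p? : Dec P) → P → 1 ∸ ind p? ≡ 0
      to (yes _) p = refl
      to (no ¬p) p = contradiction p ¬p
      from : ∀ {P} (p? : Dec P) → 1 ∸ ind p? ≡ 0 → P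
      from (yes p) _ = p

    -- `room` guarantees that strings above the stem have at least `width` children, as `escape`
    -- requires; it persists upwards since the bound is nondecreasing.
    record Condition : Set₁ where
      field
        stem    : List ℕ
        bounded : Bounded stem
        bad     : Pred (List ℕ) 0ℓ
        closed  : Closed bad
        width   : ℕ
        small   : Small width bad stem
        room    : width ≤ bound (length stem)
    open Condition

    infix 4 _⊑_
    record _⊑_ (c′ c : Condition) : Set where
      field
        {height} : ℕ
        extends  : Ext height (stem c) (stem c′)
        bad⊆bad  : bad c ⊆ bad c′
    open _⊑_

    record Meets (Y : ℕ → ℕ) (c : Condition) : Set where
      field
        initial : stem c ≡ Y ↾ length (stem c)
        avoids  : ∀ n → ¬ bad c (Y ↾ n)
    open Meets

    Guessed : Code ⊤ 1 → ℕ → (ℕ → ℕ) → Set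
    Guessed Γ d Z = ∃[ a ] (d ≤ a × ∃[ j ] (j ≤ maxInput a × guess Γ · (j ∷ []) ⇓ Z (point a)))

    -- The bound on `Z` leaves finitely many possible outputs at each point, which the pigeonhole
    -- argument requires; codes of initial segments of a bit sequence satisfy it.
    Forced : Code ⊤ 1 → ℕ → (ℕ → ℕ) → Set
    Forced Γ d Y = ∀ Z → (∀ n → (λ (_ : ⊤) → Y) ⊢ Γ · (n ∷ []) ⇓ Z n) →
                   (∀ a → Z (point a) < colours a) → Guessed Γ d Z

    -- Convergence is expressed through all long extensions, so that it is inherited by extensions
    -- at once and can be added to a bad set, which must be closed.
    Stable : Code ⊤ 1 → ℕ → ℕ → Pred (List ℕ) 0ℓ
    Stable Γ a y τ = ∃[ b ] (∀ {m τ′} → Ext m τ τ′ → b ≤ length τ′ → Outputs Γ a (length τ′) y τ′)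

    stable-↾ : ∀ {Γ a y Y} → (λ (_ : ⊤) → Y) ⊢ Γ · (point a ∷ []) ⇓ y → ∃[ n ] Stable Γ a y (Y ↾ n)
    stable-↾ {Y = Y} p with b , q ← run-complete p = b , b , λ {_} {τ′} e b≤ →
      settled q (length τ′) (index τ′) b≤ λ i i<b → trans (entry-index τ′ i (<-≤-trans i<b b≤))
        (cong suc (trans (ext-‼ i e (≤-trans i<b (≤-reflexive (sym (length-↾ Y b))))) (↾-‼ Y i i<b)))

    outputs-sound : ∀ {Γ a y Y τ} → τ ≡ Y ↾ length τ → Outputs Γ a (length τ) y τ →
                    (λ (_ : ⊤) → Y) ⊢ Γ · (point a ∷ []) ⇓ y
    outputs-sound {Γ} {a} {y} {Y} {τ} τ≡ out = run-sound agrees Γ (point a ∷ []) y out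
      where
      agrees : ∀ i z → entry (length τ) (index τ) i ≡ suc z → Y i ≡ z
      agrees i z p with i <? length τ
      ... | no i≮   = contradiction (trans (sym p) (entry-beyond (index τ) (≮⇒≥ i≮))) 1+n≢0
      ... | yes i<  = suc-injective (begin
        suc (Y i)                       ≡⟨ cong suc (↾-‼ Y i i<) ⟨
        suc ((Y ↾ length τ) ‼ i)        ≡⟨ cong (λ τ → suc (τ ‼ i)) τ≡ ⟨
        suc (τ ‼ i)                     ≡⟨ entry-index τ i i< ⟨
        entry (length τ) (index τ) i    ≡⟨ p ⟩
        suc z                           ∎)
        where open ≡-Reasoning

    ConvergesAt : Code ⊤ 1 → ℕ → Pred (List ℕ) 0ℓ
    ConvergesAt Γ a τ = ∃[ y ] (y < colours a × Stable Γ a y τ)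

    -- The pigeonhole principle supplies a value `y` and `big-uniform` a level `b` past which it is
    -- output. The trial `pair y b` names `y` and, exceeding `b`, is also a sufficient height.
    some-verdict : ∀ Γ {a σ m} → length σ ≡ a → Bounded σ → a ≤ bound a →
                   Big (colours a * a) (ConvergesAt Γ a) m σ → ∃[ w ] verdict Γ w (pair a (index σ)) ≡ 0
    some-verdict Γ {a} {σ} {m} refl bounded a≤ big =
      w , proj₁ (verdict-zero Γ w refl bounded)
        (subst (λ y → Big a (Outputs Γ a (w + a) y) w σ) (sym (π₁-pair y b)) (proj₂ limit w (<⇒≤ (b<pair y b))))
      where
      colours≡ : suc (pred (colours a)) ≡ colours a
      colours≡ = suc-pred (colours a) {{>-nonZero (subst (0 <_) (colours-unfold a) (m^n>0 2 (suc (point a))))}}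
      coloured : ∃[ y ] Big a (Stable Γ a y) m σ
      coloured = big-pigeonhole (Stable Γ a) (pred (colours a)) m
        (subst (λ c → Big (c * a) (λ τ → ∃[ y ] (y < c × Stable Γ a y τ)) m σ) (sym colours≡) big)
      y = proj₁ coloured
      limit : ∃[ b ] (∀ n → b ≤ n → Big a (Outputs Γ a (n + a) y) n σ)
      limit = big-uniform {E = λ t → Outputs Γ a t y} id m a≤ (proj₂ coloured)
      b = proj₁ limit
      w = pair y b

    record Reach (c : Condition) (d : ℕ) : Set where
      field
        {top}   : List ℕ
        {rise}  : ℕ
        ext-top : Ext rise (stem c) top
        break   : Breakpoint (length top)
        d≤      : d ≤ length top
        narrow  : Small (length top) (bad c) top

    -- `escape` with a trivial target merely climbs while the bad set stays small. A breakpoint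
    -- beyond `width c` makes the bad set small for the length of the new string.
    reach : ∀ c d → Reach c d
    reach c d
      with a , e≤a , a-break ← breakpoint-above (length (stem c) + (width c + d))
      with τ , e , _ , s ← escape {A = λ _ → ⊤} (a ∸ length (stem c)) (closed c) (room c)
                             (big-full (a ∸ length (stem c)) (room c) _) (small c)
      with refl ← trans (ext-length e) (m∸n+n≡m (m+n≤o⇒m≤o (length (stem c)) e≤a)) = record
      { ext-top = e
      ; break   = a-break
      ; d≤      = m+n≤o⇒n≤o (width c) (m+n≤o⇒n≤o (length (stem c)) e≤a)
      ; narrow  = small-mono (m+n≤o⇒m≤o (width c) (m+n≤o⇒n≤o (length (stem c)) e≤a)) s
      }

    ForcedBelow : Code ⊤ 1 → ℕ → Condition → Set₁
    ForcedBelow Γ d c =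
      Σ[ c′ ∈ Condition ] (c′ ⊑ c × d ≤ length (stem c′) × (∀ Y → Meets Y c′ → Forced Γ d Y))

    module _ (Γ : Code ⊤ 1) {d : ℕ} {c : Condition} (r : Reach c d) where
      open Reach r

      private
        a = length top

        top-bounded : Bounded top
        top-bounded = ext-bounded ext-top (bounded c)

        gap≤bound : ∀ {l} → a ≤ l → gap a ≤ bound l
        gap≤bound a≤l = ≤-trans (≤-reflexive (cong gap (sym break))) (bound-mono a≤l)

        a≤bound : ∀ {l} → a ≤ l → a ≤ bound l
        a≤bound a≤l = ≤-trans (m+n≤o⇒m≤o a (colours≤gap a)) (gap≤bound a≤l)

      -- By `big-∪` the union of the old bad set with the strings of convergence is small for the
      -- sum of the two widths, for which `gap` has room. A computation from `Y` would be stable on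
      -- some initial segment, which `Y` has to avoid.
      force-divergence : (∀ m → ¬ Big (colours a * a) (ConvergesAt Γ a) m top) → ForcedBelow Γ d c
      force-divergence never = c′ , record { extends = ext-top ; bad⊆bad = inj₁ } , d≤ ,
        λ Y meets Z computes Z< → let n , s = stable-↾ {Γ} {a} (computes (point a)) in
          contradiction (inj₂ (Z (point a) , Z< a , s)) (avoids meets n)
        where
        c′ : Condition
        c′ = record
          { stem    = top
          ; bounded = top-bounded
          ; bad     = bad c ∪ ConvergesAt Γ a
          ; closed  = λ { i< (inj₁ b) → inj₁ (closed c i< b)
                        ; i< (inj₂ (y , y< , b , s)) → inj₂ (y , y< , b , λ e → s (step i< e)) }
          ; width   = a + colours a * a
          ; small   = λ m big → [ narrow m , never m ]′ (big-∪ {a} {colours a * a} m big)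
          ; room    = ≤-trans (colours≤gap a) (gap≤bound ≤-refl)
          }

      -- The new stem is a leaf of the tree that the machine finds, not of the one given. On this
      -- leaf Γ already outputs the guess, so `Z` must agree with it.
      force-guess : ∀ m → Big (colours a * a) (ConvergesAt Γ a) m top → ForcedBelow Γ d c
      force-guess m big
        with w₀ , w₀-zero ← some-verdict Γ {m = m} refl top-bounded (a≤bound ≤-refl) big
        with w , w-zero , halted ← guess-halts Γ (pair a (index top)) w₀ w₀-zero
        with τ , ext-τ , out , small-τ ← escape w (closed c) (a≤bound ≤-refl)
               (proj₂ (verdict-zero Γ w refl top-bounded) w-zero) narrow =
        c′ , record { extends = proj₂ (ext-trans ext-top ext-τ) ; bad⊆bad = id } ,
        ≤-trans d≤ (ext-≤ ext-τ) , λ Y meets Z computes _ →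
          a , d≤ , pair a (index top) , input≤ , subst (guess Γ · (pair a (index top) ∷ []) ⇓_)
            (deterministic (outputs-sound {Γ} {a} (initial meets) (at-τ out)) (computes (point a))) halted
        where
        input≤ : pair a (index top) ≤ maxInput a
        input≤ = subst (pair a (index top) ≤_) (maxInput-unfold a) (pair-mono {a} {d = stringBound a a} ≤-refl
          (<⇒≤ (index<stringBound top-bounded ≤-refl λ i i< → bound-below break i<)))
        at-τ : Outputs Γ a (w + a) (π₁ w) τ → Outputs Γ a (length τ) (π₁ w) τ
        at-τ = subst (λ l → Outputs Γ a l (π₁ w) τ) (sym (ext-length ext-τ))
        c′ : Condition
        c′ = record
          { stem    = τ
          ; bounded = ext-bounded ext-τ top-bounded
          ; bad     = bad c
          ; closed  = closed c
          ; width   = a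
          ; small   = small-τ
          ; room    = a≤bound (ext-≤ ext-τ)
          }

    opaque
      force : ∀ Γ d c → ForcedBelow Γ d c
      force Γ d c with r ← reach c d
        with em {∃[ m ] Big (colours (length (Reach.top r)) * length (Reach.top r))
                            (ConvergesAt Γ (length (Reach.top r))) m (Reach.top r)}
      ... | yes (m , big) = force-guess Γ r m big
      ... | no never      = force-divergence Γ r (λ m big → never (m , big))

    module Generic (ψ : PR 1) (tasks : ℕ → Code ⊤ 1 × ℕ) where

      Hits : Pred (List ℕ) 0ℓ
      Hits []      = ⊥
      Hits (i ∷ τ) = ψ · (length τ ∷ []) ⇓ i ⊎ Hits τ

      -- Two children of a string that misses `ψ` cannot both hit it for the first time, because `ψ`
      -- has at most one value at that argument.
      hits-small : ∀ m {σ} → Big 2 Hits m σ → Hits σ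
      hits-small zero    hit = hit
      hits-small (suc m) {σ} big with em {Hits σ}
      ... | yes hit = hit
      ... | no miss = contradiction
        (≤-trans big (≤-trans (count-mono (bound (length σ)) (λ i _ → first ∘ hits-small m))
                              (count-unique (bound (length σ)) deterministic)))
        (<⇒≱ ≤-refl)
        where
        first : ∀ {i} → Hits (i ∷ σ) → ψ · (length σ ∷ []) ⇓ i
        first = [ id , (λ hit → contradiction hit miss) ]′

      initially : Condition
      initially = record
        { stem = [] ; bounded = [] ; bad = Hits ; closed = λ _ → inj₂ ; width = 2
        ; small = λ m → hits-small m ; room = 2≤bound 0 }

      stage : ℕ → Condition
      stage zero    = initially
      -- Besides the demand of the task, `suc s` makes the stems grow, so that their limit is total.
      stage (suc s) = proj₁ (force (proj₁ (tasks s)) (proj₂ (tasks s) ⊔ suc s) (stage s))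

      forced = λ s → proj₂ (force (proj₁ (tasks s)) (proj₂ (tasks s) ⊔ suc s) (stage s))

      stem-long : ∀ s → s ≤ length (stem (stage s))
      stem-long zero    = z≤n
      stem-long (suc s) = m⊔n≤o⇒n≤o (proj₂ (tasks s)) (suc s) (proj₁ (proj₂ (forced s)))

      stage-mono : ∀ {s t} → s ≤ t → (∃[ m ] Ext m (stem (stage s)) (stem (stage t))) × bad (stage s) ⊆ bad (stage t)
      stage-mono s≤t = go (≤⇒≤′ s≤t)
        where
        go : ∀ {s t} → s ≤′ t → (∃[ m ] Ext m (stem (stage s)) (stem (stage t))) × bad (stage s) ⊆ bad (stage t)
        go ≤′-refl = (0 , done) , id
        go (≤′-step {t} s≤t) with go s≤t | proj₁ (forced t)
        ... | (_ , e) , bad⊆ | r = ext-trans e (extends r) , bad⊆bad r ∘ bad⊆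

      generic : ℕ → ℕ
      generic n = stem (stage (suc n)) ‼ n

      stem-‼ : ∀ s i → i < length (stem (stage s)) → stem (stage s) ‼ i ≡ generic i
      stem-‼ s i i< with ≤-total s (suc i)
      ... | inj₁ s≤ = sym (ext-‼ i (proj₂ (proj₁ (stage-mono s≤))) i<)
      ... | inj₂ ≤s = ext-‼ i (proj₂ (proj₁ (stage-mono ≤s))) (stem-long (suc i))

      stem-initial : ∀ s → stem (stage s) ≡ generic ↾ length (stem (stage s))
      stem-initial s = ‼-↾ (stem (stage s)) (stem-‼ s)

      bounded-‼ : ∀ {τ} i → Bounded τ → i < length τ → τ ‼ i < bound i
      bounded-‼ {b ∷ τ} i (b< ∷ p) i<1+n with i ≟ length τ
      ... | yes refl = b<
      ... | no i≢    = bounded-‼ i p (≤∧≢⇒< (s≤s⁻¹ i<1+n) i≢)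

      generic-bounded : ∀ n → generic n < bound n
      generic-bounded n = bounded-‼ n (bounded (stage (suc n))) (stem-long (suc n))

      closed-↾ : ∀ {B m n} → Closed B → m ≤ n → B (generic ↾ m) → B (generic ↾ n)
      closed-↾ {B} closed m≤n = go (≤⇒≤′ m≤n)
        where
        go : ∀ {m n} → m ≤′ n → B (generic ↾ m) → B (generic ↾ n)
        go ≤′-refl           b = b
        go (≤′-step {n} m≤n) b = closed
          (subst (λ l → generic n < bound l) (sym (length-↾ generic n)) (generic-bounded n)) (go m≤n b)

      -- A bad initial segment would, by closure and the growth of the bad sets, make the stem of a
      -- later stage bad; at height 0 this contradicts smallness.
      generic-meets : ∀ s → Meets generic (stage s)
      generic-meets s = record { initial = stem-initial s ; avoids = avoid }
        where
        avoid : ∀ n → ¬ bad (stage s) (generic ↾ n)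
        avoid n b = small (stage t) 0 (subst (bad (stage t)) (sym (stem-initial t))
          (closed-↾ {bad (stage t)} (closed (stage t)) (≤-trans (m≤n⊔m s n) (stem-long t))
            (proj₂ (stage-mono (m≤m⊔n s n)) b)))
          where t = s ⊔ n

      generic-avoids : ¬ (∃[ n ] (ψ · (n ∷ []) ⇓ generic n))
      generic-avoids (n , p) = avoids (generic-meets 0) (suc n)
        (inj₁ (subst (λ l → ψ · (l ∷ []) ⇓ generic n) (sym (length-↾ generic n)) p))

      generic-forced : ∀ s → Forced (proj₁ (tasks s)) (proj₂ (tasks s)) generic
      generic-forced s Z computes Z<
        with a , ≤a , rest ← proj₂ (proj₂ (forced s)) generic (generic-meets (suc s)) Z computes Z< =
        a , m⊔n≤o⇒m≤o (proj₂ (tasks s)) (suc s) ≤a , rest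

-- Prefix-free machines, linear universality and short programs

module Machines where

  open import Data.Nat
  open import Data.Nat.Properties
  open import Data.Nat.Tactic.RingSolver using (solve-∀)
  open Recursive
  open Pairing
  open Bound

  private variable
    n m : ℕ

  encode-++ : ∀ σ τ → encode (σ ⌢ τ) ≡ encode σ + 2 ^ length σ * encode τ
  encode-++ []      τ = sym (*-identityˡ (encode τ))
  encode-++ (b ∷ σ) τ rewrite encode-++ σ τ = ring (toℕ b) (encode σ) (2 ^ length σ) (encode τ)
    where
    ring : ∀ b e p f → suc (b + 2 * (e + p * f)) ≡ suc (b + 2 * e) + (2 * p) * f
    ring = solve-∀

  encode-bound : ∀ σ → encode σ + 2 ≤ 2 ^ suc (length σ)
  encode-bound []      = ≤-refl
  encode-bound (b ∷ σ) = begin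
    suc (toℕ b + 2 * encode σ) + 2 ≤⟨ +-monoˡ-≤ 2 (+-monoˡ-≤ (2 * encode σ) (toℕ<n b)) ⟩
    2 + 2 * encode σ + 2           ≡⟨ ring (encode σ) ⟩
    2 * (encode σ + 2)             ≤⟨ *-monoʳ-≤ 2 (encode-bound σ) ⟩
    2 * 2 ^ suc (length σ)         ∎
    where
    open ≤-Reasoning
    ring : ∀ e → 2 + 2 * e + 2 ≡ 2 * (e + 2)
    ring = solve-∀

  encode-injective : ∀ σ τ → encode σ ≡ encode τ → σ ≡ τ
  encode-injective []       []       _  = refl
  encode-injective (0F ∷ σ) (0F ∷ τ) eq =
    cong (0F ∷_) (encode-injective σ τ (*-cancelˡ-≡ _ _ 2 (suc-injective eq)))
  encode-injective (1F ∷ σ) (1F ∷ τ) eq =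
    cong (1F ∷_) (encode-injective σ τ (*-cancelˡ-≡ _ _ 2 (suc-injective (suc-injective eq))))
  encode-injective (0F ∷ σ) (1F ∷ τ) eq = contradiction (suc-injective eq) (even≢odd (encode σ) (encode τ))
  encode-injective (1F ∷ σ) (0F ∷ τ) eq = contradiction (suc-injective (sym eq)) (even≢odd (encode τ) (encode σ))

  increment : String → String
  increment []       = 0F ∷ []
  increment (0F ∷ σ) = 1F ∷ σ
  increment (1F ∷ σ) = 0F ∷ increment σ

  encode-increment : ∀ σ → encode (increment σ) ≡ suc (encode σ)
  encode-increment []       = refl
  encode-increment (0F ∷ σ) = refl
  encode-increment (1F ∷ σ) = cong suc (trans (cong (2 *_) (encode-increment σ)) (*-suc 2 (encode σ)))

  decode : ℕ → String
  decode zero    = []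
  decode (suc k) = increment (decode k)

  encode-decode : ∀ k → encode (decode k) ≡ k
  encode-decode zero    = refl
  encode-decode (suc k) = trans (encode-increment (decode k)) (cong suc (encode-decode k))

  unary : ℕ → String
  unary zero    = 1F ∷ []
  unary (suc j) = 0F ∷ unary j

  length-unary : ∀ j → length (unary j) ≡ suc j
  length-unary zero    = refl
  length-unary (suc j) = cong suc (length-unary j)

  -- The closed form by which a machine recognises unary strings and an address in `U` is computed
  -- from `j`.
  encode-unary : ∀ j → suc (encode (unary j)) ≡ 3 * 2 ^ j
  encode-unary zero    = refl
  encode-unary (suc j) = begin
    2 + 2 * encode (unary j)     ≡⟨ *-suc 2 (encode (unary j)) ⟨
    2 * suc (encode (unary j))   ≡⟨ cong (2 *_) (encode-unary j) ⟩
    2 * (3 * 2 ^ j)              ≡⟨ ring (2 ^ j) ⟩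
    3 * (2 * 2 ^ j)              ∎
    where
    open ≡-Reasoning
    ring : ∀ p → 2 * (3 * p) ≡ 3 * (2 * p)
    ring = solve-∀

  unary-prefix : ∀ i j → Prefix _≡_ (unary i) (unary j) → unary i ≡ unary j
  unary-prefix zero    zero    _ = refl
  unary-prefix zero    (suc j) (() ∷ _)
  unary-prefix (suc i) zero    (() ∷ _)
  unary-prefix (suc i) (suc j) (_ ∷ p) = cong (0F ∷_) (unary-prefix i j p)

  compose : ∀ {O} → Code O 1 → Rec n → Code O n
  compose e r = compᶜ e (code r ∷ [])

  compose-⇔ : ∀ {O} {φ : O → ℕ → ℕ} (e : Code O 1) (r : Rec n) {xs y} →
              φ ⊢ compose e r · xs ⇓ y ⇔ φ ⊢ e · (⟦ r ⟧ xs ∷ []) ⇓ y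
  compose-⇔ {φ = φ} e r {xs} = mk⇔
    (λ { (comp⇓ (p ∷ []) q) → subst (λ z → φ ⊢ e · (z ∷ []) ⇓ _) (deterministic p (halts r xs)) q })
    (comp⇓ (halts r xs ∷ []))

  private
    notUnary : Rec 2
    notUnary = lit 1 ∸ᴿ eqᴿ (succ (var 1F)) (lit 3 *ᴿ 2^ᴿ (var 0F))

  -- On a string that is not unary the search for its exponent never ends, so the domain lies in a
  -- prefix-free set and any `θ` becomes a prefix-free machine.
  unaryMachine : PR 1 → PR 1
  unaryMachine θ = compᶜ θ (minᶜ (code notUnary) ∷ [])

  private
    notUnary-value : ∀ j i → ⟦ notUnary ⟧ (i ∷ encode (unary j) ∷ []) ≡ 1 ∸ eq (3 * 2 ^ j) (3 * 2 ^ i)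
    notUnary-value j i = cong (λ z → 1 ∸ eq z (3 * 2 ^ i)) (encode-unary j)

    2^-injective : ∀ {i j} → 2 ^ i ≡ 2 ^ j → i ≡ j
    2^-injective {i} {j} p = proj₁ (pair-injective i 0 j 0 (cong (_* 1) p))

  unaryMachine-run : ∀ {θ j y} → θ · (j ∷ []) ⇓ y → unaryMachine θ · (encode (unary j) ∷ []) ⇓ y
  unaryMachine-run {θ} {j} p = comp⇓ (min⇓ (λ i i<j → 0 , value i
      (cong (1 ∸_) (eq-≢ (λ q → <⇒≢ i<j (sym (2^-injective (*-cancelˡ-≡ _ _ 3 q)))))))
    (value j (cong (1 ∸_) (eq-refl (3 * 2 ^ j)))) ∷ []) p
    where
    value : ∀ i {z} → 1 ∸ eq (3 * 2 ^ j) (3 * 2 ^ i) ≡ z → code notUnary · (i ∷ encode (unary j) ∷ []) ⇓ z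
    value i q = subst (code notUnary · (i ∷ encode (unary j) ∷ []) ⇓_) (trans (notUnary-value j i) q)
                  (halts notUnary (i ∷ encode (unary j) ∷ []))

  unaryMachine-dom : ∀ {θ} σ {y} → unaryMachine θ · (encode σ ∷ []) ⇓ y →
                     ∃[ j ] (σ ≡ unary j × θ · (j ∷ []) ⇓ y)
  unaryMachine-dom σ (comp⇓ (min⇓ {k = j} _ p ∷ []) q) with suc (encode σ) ≟ 3 * 2 ^ j
  ... | yes ≡3*2^j = j , encode-injective σ (unary j) (suc-injective (trans ≡3*2^j (sym (encode-unary j)))) , q
  ... | no ≢3*2^j  = contradiction
    (trans (deterministic p (halts notUnary (j ∷ encode σ ∷ []))) (cong (1 ∸_) (eq-≢ ≢3*2^j))) 0≢1+n

  unaryMachine-prefixFree : ∀ θ → PrefixFreeMachine (unaryMachine θ)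
  unaryMachine-prefixFree θ {σ} {τ} (_ , p) (_ , q) σ≤τ
    with i , refl , _ ← unaryMachine-dom {θ} σ p | j , refl , _ ← unaryMachine-dom {θ} τ q = unary-prefix i j σ≤τ

  Simulates : PR 1 → String → PR 1 → Set
  Simulates U ρ θ = ∀ j y → U · (encode (ρ ⌢ unary j) ∷ []) ⇓ y ⇔ θ · (j ∷ []) ⇓ y

  module _ {U : PR 1} (universal : Universal U) where
    open Universal universal

    simulate : ∀ θ → ∃[ ρ ] Simulates U ρ θ
    simulate θ with ρ , sim ← simulates (unaryMachine θ) (unaryMachine-prefixFree θ) = ρ , λ j y →
      subst (λ y → U · (encode (ρ ⌢ unary j) ∷ []) ⇓ y ⇔ θ · (j ∷ []) ⇓ y) (encode-decode y) (mk⇔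
        (λ p → let i , j≡i , q = unaryMachine-dom {θ} (unary j) (Equivalence.to (sim (unary j) (decode y)) p) in
          subst (λ k → θ · (k ∷ []) ⇓ _)
            (suc-injective (trans (sym (length-unary i)) (trans (cong length (sym j≡i)) (length-unary j)))) q)
        (λ p → Equivalence.from (sim (unary j) (decode y)) (unaryMachine-run {θ} p)))

    opaque
      -- This evaluates `encode-++` with `encode-unary` inserted; both the length and the code of
      -- `ρ` enter, hence the inner pair.
      address : Rec 1
      address = π₂ᴿ (π₁ᴿ (var 0F)) +ᴿ 2^ᴿ (π₁ᴿ (π₁ᴿ (var 0F))) *ᴿ (lit 3 *ᴿ 2^ᴿ (π₂ᴿ (var 0F)) ∸ᴿ lit 1)

      address-value : ∀ ρ x → ⟦ address ⟧ (pair (pair (length ρ) (encode ρ)) x ∷ []) ≡ encode (ρ ⌢ unary x)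
      address-value ρ x
        rewrite π₁-pair (pair (length ρ) (encode ρ)) x | π₂-pair (pair (length ρ) (encode ρ)) x
              | π₁-pair (length ρ) (encode ρ) | π₂-pair (length ρ) (encode ρ) =
        trans (cong (λ u → encode ρ + 2 ^ length ρ * (u ∸ 1)) (sym (encode-unary x))) (sym (encode-++ ρ (unary x)))

    -- For i fixed, pair i x = 2 ^ suc i * x + 2 ^ i is linear in x.
    linear : PR 1
    linear = compose U address

    linear-at : ∀ ρ x {m y} → m ≡ pair (pair (length ρ) (encode ρ)) x →
                linear · (m ∷ []) ⇓ y ⇔ U · (encode (ρ ⌢ unary x) ∷ []) ⇓ y
    linear-at ρ x {y = y} refl =
      subst (λ z → linear · (pair (pair (length ρ) (encode ρ)) x ∷ []) ⇓ y ⇔ U · (z ∷ []) ⇓ y)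
        (address-value ρ x) (compose-⇔ U address)

    linear-universal : LinearlyUniversal linear
    linear-universal θ = 2 * p , p , λ x y → ⇔-trans (linear-at ρ x (ring p x)) (proj₂ (simulate θ) x y)
      where
      ρ : String
      ρ = proj₁ (simulate θ)
      p : ℕ
      p = 2 ^ pair (length ρ) (encode ρ)
      ring : ∀ p x → 2 * p * x + p ≡ p * suc (2 * x)
      ring = solve-∀

  -- Complexity is a relation that demands minimality, so a value is obtained by descending through
  -- shorter programs while any exist.
  least-program : ExcludedMiddle 0ℓ → ∀ {U σ} τ → U ⟨ τ ⟩≃ σ → ∃[ k ] (K[ U ] σ ≡ k × k ≤ length τ)
  least-program em {U} {σ} τ p = go (length τ) τ p ≤-refl
    where
    go : ∀ l τ → U ⟨ τ ⟩≃ σ → length τ ≤ l → ∃[ k ] (K[ U ] σ ≡ k × k ≤ l)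
    go l τ p ≤l with em {∃[ υ ] (length υ < length τ × U ⟨ υ ⟩≃ σ)}
    ... | no none = length τ , ((τ , refl , p) , λ υ q → ≮⇒≥ (λ υ<τ → none (υ , υ<τ , q))) , ≤l
    go zero    τ p ≤l | yes (υ , υ<τ , q) = contradiction (<-≤-trans υ<τ ≤l) λ ()
    go (suc l) τ p ≤l | yes (υ , υ<τ , q) with k , K≡k , k≤l ← go l υ q (s≤s⁻¹ (<-≤-trans υ<τ ≤l)) =
      k , K≡k , m≤n⇒m≤1+n k≤l

  appendBit : Rec 3
  appendBit = var 1F +ᴿ 2^ᴿ (var 0F) *ᴿ succ (var 2F)

  -- A reduction to bits becomes one to codes of whole initial segments, so that a single output at
  -- `point a` is an entire string to be compressed.
  initialCode : ∀ {O} → Code O 1 → Code O 1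
  initialCode e = precᶜ zeroᶜ (compᶜ (code appendBit) (projᶜ 0F ∷ projᶜ 1F ∷ compᶜ e (projᶜ 0F ∷ []) ∷ []))
  initialCode-computes : ∀ {O} {φ : O → ℕ → ℕ} {e} (X : ℕ → Bit) → (∀ i → φ ⊢ e · (i ∷ []) ⇓ toℕ (X i)) →
                         ∀ n → φ ⊢ initialCode e · (n ∷ []) ⇓ encode (substring X 0 n)
  initialCode-computes X computes zero = prec0⇓ zero⇓
  initialCode-computes {φ = φ} {e} X computes (suc n) = precs⇓ (initialCode-computes X computes n)
    (subst (_⊢_·_⇓_ φ _ _) value (comp⇓
      (proj⇓ 0F ∷ proj⇓ 1F ∷ comp⇓ (proj⇓ 0F ∷ []) (computes n) ∷ []) (halts appendBit (n ∷ encode (substring X 0 n) ∷ toℕ (X n) ∷ []))))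
    where
    open ≡-Reasoning
    value : encode (substring X 0 n) + 2 ^ n * suc (toℕ (X n)) ≡ encode (substring X 0 (suc n))
    value = begin
      encode (substring X 0 n) + 2 ^ n * suc (toℕ (X n))
        ≡⟨ cong₂ (λ l b → encode (substring X 0 n) + 2 ^ l * suc b)
             (sym (length-applyUpTo X n)) (sym (+-identityʳ (toℕ (X n)))) ⟩
      encode (substring X 0 n) + 2 ^ length (substring X 0 n) * encode (X n ∷ [])
        ≡⟨ encode-++ (substring X 0 n) (X n ∷ []) ⟨
      encode (substring X 0 n ⌢ (X n ∷ []))
        ≡⟨ cong encode (applyUpTo-∷ʳ X n) ⟩
      encode (substring X 0 (suc n)) ∎

-- Listing all oracle programs as tasks

module Enumeration where

  open import Data.Nat
  open import Data.Nat.Properties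
  open Recursive
  open Pairing

  private variable
    n m : ℕ

  mutual
    -- Fuel makes the recursion structural. Numbers that code nothing yield `minᶜ (projᶜ 0F)`, a
    -- program for the constant 0; the aim is surjectivity.
    decodeCode : ℕ → ∀ n → ℕ → Code ⊤ n
    decodeCode zero       n c = minᶜ (projᶜ 0F)
    decodeCode (suc fuel) n c = decodeNode fuel (π₁ c) n (π₂ c)

    decodeNode : ℕ → ℕ → ∀ n → ℕ → Code ⊤ n
    decodeNode fuel 0 0 c = zeroᶜ
    decodeNode fuel 0 1 c = sucᶜ
    decodeNode fuel 1 1 c = queryᶜ tt
    decodeNode fuel 2 (suc n) c = precᶜ (decodeCode fuel n (π₁ c)) (decodeCode fuel (2 + n) (π₂ c))
    decodeNode fuel 3 n c = minᶜ (decodeCode fuel (suc n) c)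
    decodeNode fuel 4 n c = compᶜ (decodeCode fuel (π₁ c) (π₁ (π₂ c))) (decodeCodes fuel n (π₁ c) (π₂ (π₂ c)))
    decodeNode fuel 5 n c with c <? n
    ... | yes c<n = projᶜ (fromℕ< c<n)
    ... | no _    = minᶜ (projᶜ 0F)
    decodeNode fuel _ n c = minᶜ (projᶜ 0F)

    decodeCodes : ℕ → ∀ n m → ℕ → Vec (Code ⊤ n) m
    decodeCodes fuel n zero    c = []
    decodeCodes fuel n (suc m) c = decodeCode fuel n (π₁ c) ∷ decodeCodes fuel n m (π₂ c)

  -- Demanded for all larger fuel, so that subprograms with different needs can share the maximum.
  Decodes : Code ⊤ n → ℕ → ℕ → Set
  Decodes {n} e c fuel = ∀ {k} → fuel ≤ k → decodeCode k n c ≡ e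

  private
    node : ∀ {e : Code ⊤ n} tag c fuel → (∀ {k} → fuel ≤ k → decodeNode k tag n c ≡ e) →
           ∃[ d ] ∃[ fuel ] Decodes e d fuel
    node {n} {e} tag c fuel p = pair tag c , suc fuel , decodes
      where
      decodes : Decodes e (pair tag c) (suc fuel)
      decodes {suc k} (s≤s ≤k) = trans (cong₂ (λ tag c → decodeNode k tag n c) (π₁-pair tag c) (π₂-pair tag c)) (p ≤k)

  mutual
    decodeCode-surjective : (e : Code ⊤ n) → ∃[ c ] ∃[ fuel ] Decodes e c fuel
    decodeCode-surjective zeroᶜ       = node 0 0 0 (λ _ → refl)
    decodeCode-surjective sucᶜ        = node 0 0 0 (λ _ → refl)
    decodeCode-surjective (queryᶜ tt) = node 1 0 0 (λ _ → refl)
    decodeCode-surjective {n} (projᶜ i) = node 5 (toℕ i) 0 λ {k} _ → decodes k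
      where
      decodes : ∀ k → decodeNode k 5 n (toℕ i) ≡ projᶜ i
      decodes k with toℕ i <? n
      ... | yes i<n = cong projᶜ (fromℕ<-toℕ i i<n)
      ... | no i≮n  = contradiction (toℕ<n i) i≮n
    decodeCode-surjective (precᶜ f g)
      with c , s , p ← decodeCode-surjective f | d , t , q ← decodeCode-surjective g =
      node 2 (pair c d) (s ⊔ t) λ {k} ≤k → cong₂ precᶜ
        (trans (cong (decodeCode k _) (π₁-pair c d)) (p (m⊔n≤o⇒m≤o s t ≤k)))
        (trans (cong (decodeCode k _) (π₂-pair c d)) (q (m⊔n≤o⇒n≤o s t ≤k)))
    decodeCode-surjective (minᶜ f) with c , s , p ← decodeCode-surjective f =
      node 3 c s λ ≤k → cong minᶜ (p ≤k)
    decodeCode-surjective {n} (compᶜ {m} f gs)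
      with c , s , p ← decodeCode-surjective f | d , t , q ← decodeCodes-surjective gs =
      node 4 (pair m (pair c d)) (s ⊔ t) λ {k} ≤k → begin
        compᶜ (decodeCode k (π₁ (pair m (pair c d))) (π₁ (π₂ (pair m (pair c d)))))
              (decodeCodes k n (π₁ (pair m (pair c d))) (π₂ (π₂ (pair m (pair c d)))))
          ≡⟨ cong₂ (λ m x → compᶜ (decodeCode k m (π₁ x)) (decodeCodes k n m (π₂ x)))
               (π₁-pair m (pair c d)) (π₂-pair m (pair c d)) ⟩
        compᶜ (decodeCode k m (π₁ (pair c d))) (decodeCodes k n m (π₂ (pair c d)))
          ≡⟨ cong₂ (λ x y → compᶜ (decodeCode k m x) (decodeCodes k n m y)) (π₁-pair c d) (π₂-pair c d) ⟩
        compᶜ (decodeCode k m c) (decodeCodes k n m d)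
          ≡⟨ cong₂ compᶜ (p (m⊔n≤o⇒m≤o s t ≤k)) (q (m⊔n≤o⇒n≤o s t ≤k)) ⟩
        compᶜ f gs ∎
      where open ≡-Reasoning

    decodeCodes-surjective : (gs : Vec (Code ⊤ n) m) →
      ∃[ c ] ∃[ fuel ] (∀ {k} → fuel ≤ k → decodeCodes k n m c ≡ gs)
    decodeCodes-surjective [] = 0 , 0 , λ _ → refl
    decodeCodes-surjective (g ∷ gs)
      with c , s , p ← decodeCode-surjective g | d , t , q ← decodeCodes-surjective gs =
      pair c d , s ⊔ t , λ {k} ≤k → cong₂ _∷_
        (trans (cong (decodeCode k _) (π₁-pair c d)) (p (m⊔n≤o⇒m≤o s t ≤k)))
        (trans (cong (decodeCodes k _ _) (π₂-pair c d)) (q (m⊔n≤o⇒n≤o s t ≤k)))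

  -- Every program is paired with every threshold, since correct guesses must occur arbitrarily far
  -- out.
  task : ℕ → Code ⊤ 1 × ℕ
  task s = decodeCode (π₁ s) 1 (π₁ (π₂ s)) , π₂ (π₂ s)

  task-surjective : ∀ e d → ∃[ s ] task s ≡ (e , d)
  task-surjective e d with c , fuel , p ← decodeCode-surjective e = pair fuel (pair c d) , (begin
    task (pair fuel (pair c d))
      ≡⟨ cong₂ (λ f x → decodeCode f 1 (π₁ x) , π₂ x) (π₁-pair fuel (pair c d)) (π₂-pair fuel (pair c d)) ⟩
    (decodeCode fuel 1 (π₁ (pair c d)) , π₂ (pair c d))
      ≡⟨ cong₂ (λ x y → decodeCode fuel 1 x , y) (π₁-pair c d) (π₂-pair c d) ⟩
    (decodeCode fuel 1 c , d) ≡⟨ cong (_, d) (p ≤-refl) ⟩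
    (e , d) ∎)
    where open ≡-Reasoning

-- The bound as a slow-growing order function, and real estimates

module Rationals where

  open import Data.Integer as ℤ using (+_; _⊖_)
  import Data.Integer.Properties as ℤₚ
  open import Data.Nat as ℕ using (ℕ; zero; suc)
  import Data.Nat.Properties as ℕₚ
  open import Data.Rational
  open import Data.Rational.Properties
  import Data.Rational.Unnormalised as ℚᵘ
  import Data.Rational.Unnormalised.Properties as ℚᵘₚ
  open import Data.Rational.Solver using (module +-*-Solver)
  open Recursive
  open Pairing
  open Bound

  opaque
    ι : ℕ → ℚ
    ι k = + k / 1

    ι-unfold : ∀ k → + k / 1 ≡ ι k
    ι-unfold k = refl

    ι-zero : ι 0 ≡ 0ℚ
    ι-zero = refl

    ι-suc : ∀ k → ι (suc k) ≡ 1ℚ + ι k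
    ι-suc k = toℚᵘ-injective (begin
      toℚᵘ (ι (suc k))               ≈⟨ toℚᵘ-fromℚᵘ (ℚᵘ.mkℚᵘ (+ suc k) 0) ⟩
      ℚᵘ.mkℚᵘ (+ suc k) 0            ≈⟨ ℚᵘ.*≡* (cong (λ z → (+ 1 ℤ.+ z) ℤ.* + 1) (sym (ℤₚ.*-identityʳ (+ k)))) ⟩
      ℚᵘ.1ℚᵘ ℚᵘ.+ ℚᵘ.mkℚᵘ (+ k) 0    ≈⟨ ℚᵘₚ.+-congʳ ℚᵘ.1ℚᵘ (toℚᵘ-fromℚᵘ (ℚᵘ.mkℚᵘ (+ k) 0)) ⟨
      toℚᵘ 1ℚ ℚᵘ.+ toℚᵘ (ι k)        ≈⟨ toℚᵘ-homo-+ 1ℚ (ι k) ⟨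
      toℚᵘ (1ℚ + ι k)                ∎)
      where open ℚᵘₚ.≃-Reasoning

  0≤ι : ∀ k → 0ℚ ≤ ι k
  0≤ι zero    = ≤-reflexive (sym ι-zero)
  0≤ι (suc k) = ≤-trans (≤-trans (<⇒≤ (positive⁻¹ 1ℚ)) (≤-reflexive (sym (+-identityʳ 1ℚ))))
    (≤-trans (+-monoʳ-≤ 1ℚ (0≤ι k)) (≤-reflexive (sym (ι-suc k))))

  ι-mono : ∀ {k l} → k ℕ.≤ l → ι k ≤ ι l
  ι-mono {l = l} ℕ.z≤n = subst (_≤ ι l) (sym ι-zero) (0≤ι l)
  ι-mono {suc k} {suc l} (ℕ.s≤s k≤l) = subst₂ _≤_ (sym (ι-suc k)) (sym (ι-suc l)) (+-monoʳ-≤ 1ℚ (ι-mono k≤l))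

  ι-+ : ∀ k l → ι (k ℕ.+ l) ≡ ι k + ι l
  ι-+ zero    l = sym (trans (cong (_+ ι l) ι-zero) (+-identityˡ (ι l)))
  ι-+ (suc k) l = begin
    ι (suc (k ℕ.+ l))  ≡⟨ ι-suc (k ℕ.+ l) ⟩
    1ℚ + ι (k ℕ.+ l)   ≡⟨ cong (_+_ 1ℚ) (ι-+ k l) ⟩
    1ℚ + (ι k + ι l)   ≡⟨ +-assoc 1ℚ (ι k) (ι l) ⟨
    1ℚ + ι k + ι l     ≡⟨ cong (_+ ι l) (ι-suc k) ⟨
    ι (suc k) + ι l    ∎
    where open ≡-Reasoning

  ι-suc-* : ∀ k x → ι (suc k) * x ≡ x + ι k * x
  ι-suc-* k x = begin
    ι (suc k) * x      ≡⟨ cong (_* x) (ι-suc k) ⟩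
    (1ℚ + ι k) * x     ≡⟨ *-distribʳ-+ x 1ℚ (ι k) ⟩
    1ℚ * x + ι k * x   ≡⟨ cong (_+ ι k * x) (*-identityˡ x) ⟩
    x + ι k * x        ∎
    where open ≡-Reasoning

  ι-* : ∀ k l → ι (k ℕ.* l) ≡ ι k * ι l
  ι-* zero    l = trans ι-zero (sym (trans (cong (_* ι l) ι-zero) (*-zeroˡ (ι l))))
  ι-* (suc k) l = trans (ι-+ l (k ℕ.* l)) (trans (cong (_+_ (ι l)) (ι-* k l)) (sym (ι-suc-* k (ι l))))

  ι-one : ι 1 ≡ 1ℚ
  ι-one = trans (ι-suc 0) (trans (cong (_+_ 1ℚ) ι-zero) (+-identityʳ 1ℚ))

  <ι-suc : ∀ k → ι k < ι (suc k)
  <ι-suc k = subst₂ _<_ (+-identityˡ (ι k)) (sym (ι-suc k)) (+-monoˡ-< (ι k) (positive⁻¹ 1ℚ))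

  ι-cancel : ∀ k l → ι k ≤ ι l → k ℕ.≤ l
  ι-cancel k l ιk≤ιl with k ℕ.≤? l
  ... | yes k≤l = k≤l
  ... | no k≰l  = contradiction (<-≤-trans (<ι-suc l) (≤-trans (ι-mono (ℕₚ.≰⇒> k≰l)) ιk≤ιl)) (<-irrefl refl)

  opaque
    unfolding ι

    archimedean : ∀ p → ∃[ k ] p ≤ ι k
    archimedean p@(mkℚ _ _ _) = k , toℚᵘ-cancel-≤ (begin
      toℚᵘ p             ≤⟨ ℚᵘ.*≤* bound′ ⟩
      ℚᵘ.mkℚᵘ (+ k) 0    ≃⟨ toℚᵘ-fromℚᵘ (ℚᵘ.mkℚᵘ (+ k) 0) ⟨
      toℚᵘ (ι k)         ∎)
      where
      open ℚᵘₚ.≤-Reasoning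
      k : ℕ
      -- The denominator is at least 1, so the absolute value of the numerator suffices.
      k = ℤ.∣ ↥ p ∣
      bound′ : ↥ p ℤ.* + 1 ℤ.≤ + k ℤ.* ↧ p
      bound′ = ℤₚ.≤-trans (ℤₚ.≤-reflexive (ℤₚ.*-identityʳ (↥ p))) (ℤₚ.≤-trans (i≤+∣i∣ (↥ p))
        (subst (ℤ._≤ + k ℤ.* ↧ p) (ℤₚ.*-identityʳ (+ k)) (ℤₚ.*-monoˡ-≤-nonNeg (+ k) (ℤ.+≤+ (ℕ.s≤s ℕ.z≤n)))))
        where
        i≤+∣i∣ : ∀ i → i ℤ.≤ + ℤ.∣ i ∣
        i≤+∣i∣ (+ _)        = ℤₚ.≤-refl
        i≤+∣i∣ ℤ.-[1+ _ ] = ℤ.-≤+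

  recip-*ˡ : ∀ p → 0ℚ < p → p * recip p ≡ 1ℚ
  recip-*ˡ p 0<p with p ≟ 0ℚ
  ... | yes p≡0 = contradiction (sym p≡0) (<⇒≢ 0<p)
  ... | no p≢0  = *-inverseʳ p {{≢-nonZero p≢0}}

  opaque
    archimedean⁻¹ : ∀ ε → 0ℚ < ε → ∃[ D ] 1ℚ ≤ ι D * ε
    archimedean⁻¹ ε 0<ε with D , ε⁻¹≤D ← archimedean (recip ε) = D ,
      subst (_≤ ι D * ε) (trans (*-comm (recip ε) ε) (recip-*ˡ ε 0<ε))
        (*-monoʳ-≤-nonNeg ε {{nonNegative (<⇒≤ 0<ε)}} ε⁻¹≤D)

  opaque
    eventually-bounded : ∀ x → ∃[ k ] ∃[ N ] (∀ n → N ℕ.≤ n → seq x n ≤ ι k)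
    eventually-bounded x
      with N , close ← cauchy x 1ℚ (positive⁻¹ 1ℚ)
      with k , ≤k ← archimedean (seq x N) =
      suc k , N , λ n N≤n → begin
        seq x n                            ≡⟨ split (seq x n) (seq x N) ⟩
        (seq x n - seq x N) + seq x N
          ≤⟨ +-monoˡ-≤ (seq x N) (≤-trans (p≤∣p∣ (seq x n - seq x N)) (<⇒≤ (close n N N≤n ℕₚ.≤-refl))) ⟩
        1ℚ + seq x N                       ≤⟨ +-monoʳ-≤ 1ℚ ≤k ⟩
        1ℚ + ι k                           ≡⟨ ι-suc k ⟨
        ι (suc k)                          ∎
      where
      open ≤-Reasoning
      open +-*-Solver
      split : ∀ a b → a ≡ (a - b) + b
      split = solve 2 (λ a b → a := (a :- b) :+ b) refl
      p≤∣p∣ : ∀ p → p ≤ ∣ p ∣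
      p≤∣p∣ p with ≤-total 0ℚ p
      ... | inj₁ 0≤p = ≤-reflexive (sym (0≤p⇒∣p∣≡p 0≤p))
      ... | inj₂ p≤0 = ≤-trans p≤0 (0≤∣p∣ p)

  ≤⇒≤ℝ : ∀ {x y} → (∀ n → seq x n ≤ seq y n) → x ≤ℝ y
  ≤⇒≤ℝ {x} {y} x≤y ε 0<ε = 0 , λ n _ → ≤-trans (x≤y n)
    (subst (_≤ seq y n + ε) (+-identityʳ (seq y n)) (+-monoʳ-≤ (seq y n) (<⇒≤ 0<ε)))

  1≤⇒<ℝ : ∀ {x y} N → (∀ n → N ℕ.≤ n → seq x n + 1ℚ ≤ seq y n) → x <ℝ y
  1≤⇒<ℝ N x+1≤y = 1ℚ , positive⁻¹ 1ℚ , N , x+1≤y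

  ι-+1 : ∀ k → ι k + 1ℚ ≡ ι (suc k)
  ι-+1 k = trans (+-comm (ι k) 1ℚ) (sym (ι-suc k))

  fromℕ-< : ∀ {k l} → k ℕ.< l → fromℕ k <ℝ fromℕ l
  fromℕ-< {k} {l} k<l = 1≤⇒<ℝ {fromℕ k} {fromℕ l} 0 λ _ _ →
    subst₂ (λ p q → p + 1ℚ ≤ q) (sym (ι-unfold k)) (sym (ι-unfold l)) (≤-trans (≤-reflexive (ι-+1 k)) (ι-mono k<l))

  opaque
    -- One more than an eventual bound of `x`: the difference 1 witnesses strictness.
    below-fromℕ : ∀ x → ∃[ k ] (∀ y → (∀ n → ι k ≤ seq y n) → x <ℝ y)
    below-fromℕ x with k , N , x≤k ← eventually-bounded x = suc k , λ y k≤y →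
      1≤⇒<ℝ {x} {y} N λ n N≤n → ≤-trans (+-monoˡ-≤ 1ℚ (x≤k n N≤n)) (≤-trans (≤-reflexive (ι-+1 k)) (k≤y n))

  boundℝ : ℕ → ℝ
  boundℝ n = fromℕ (bound n)

  1<bound : MapsInto⟨1,∞⟩ boundℝ
  1<bound n = 1≤⇒<ℝ {constant 1ℚ} {boundℝ n} 0 λ _ _ →
    subst₂ _≤_ (trans (ι-suc 1) (cong (_+_ 1ℚ) ι-one)) (sym (ι-unfold (bound n))) (ι-mono (2≤bound n))

  uniformlyComputable : (f : Rec 1) → UniformlyComputable (λ n → fromℕ (⟦ f ⟧ (n ∷ [])))
  uniformlyComputable f = (λ n _ → value n) , (λ _ _ → 0) , (λ _ _ → 0) ,
    recursive (comp f (var 0F ∷ [])) , recursive (lit 0) , recursive (lit 0) ,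
    λ n k → close n k (fromℕ (value n)) (constant ((value n ⊖ 0) / 1))
              (λ _ → cong (_/ 1) (sym (ℤₚ.⊖-≥ {value n} ℕ.z≤n))) ,
            close n k (constant ((value n ⊖ 0) / 1)) (fromℕ (value n)) (λ _ → cong (_/ 1) (ℤₚ.⊖-≥ {value n} ℕ.z≤n))
    where
    value : ℕ → ℕ
    value n = ⟦ f ⟧ (n ∷ [])
    recursive : (g : Rec 2) → Recursive₂ (λ m n → ⟦ g ⟧ (m ∷ n ∷ []))
    recursive g = code g , λ m n → halts g (m ∷ n ∷ [])
    close : ∀ n k x y → (∀ i → seq x i ≡ seq y i) →
            (x -ℝ y) ≤ℝ constant ((+ 1 / (2 ℕ.^ k)) {{ℕₚ.m^n≢0 2 k}})
    close n k x y x≡y = ≤⇒≤ℝ {x -ℝ y} {constant ((+ 1 / (2 ℕ.^ k)) {{ℕₚ.m^n≢0 2 k}})} λ i →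
      ≤-trans (≤-reflexive (trans (cong (_- seq y i) (x≡y i)) (+-inverseʳ (seq y i))))
        (nonNegative⁻¹ ((+ 1 / (2 ℕ.^ k)) {{ℕₚ.m^n≢0 2 k}}) {{normalize-nonNeg 1 (2 ℕ.^ k) {{ℕₚ.m^n≢0 2 k}}}})

  bound-isOrder : IsOrder boundℝ
  bound-isOrder = record
    { computable    = uniformlyComputable (boundᴿ (var 0F))
    ; nondecreasing = λ {m} {n} m≤n → ≤⇒≤ℝ {boundℝ m} {boundℝ n} λ _ →
        subst₂ _≤_ (sym (ι-unfold (bound m))) (sym (ι-unfold (bound n))) (ι-mono (bound-mono m≤n))
    ; unbounded     = unbounded
    }
    where
    unbounded : ∀ B → ∃[ n ] (B <ℝ boundℝ n)
    unbounded B with k , below ← below-fromℕ B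
      with a , k≤a , p ← breakpoint-above k = a , below (boundℝ a) λ _ → subst (ι k ≤_) (sym (ι-unfold (bound a)))
        (ι-mono (ℕₚ.≤-trans k≤a
          (ℕₚ.≤-trans (ℕₚ.m+n≤o⇒m≤o a (colours≤gap a)) (ℕₚ.≤-reflexive (cong gap (sym p))))))

  reciprocals : ℕ → ℝ
  reciprocals n = boundℝ n ⁻¹[ 1<⇒0< {boundℝ n} (1<bound n) ]

  opaque
    partialSum : ℕ → ℕ → ℚ
    partialSum N m = seq (sumBelow reciprocals N) m

    partialSum-unfold : ∀ N m → seq (sumBelow reciprocals N) m ≡ partialSum N m
    partialSum-unfold N m = refl

    partialSum-zero : ∀ m → partialSum 0 m ≡ 0ℚ
    partialSum-zero m = refl

    sum-block : ∀ {a} → Breakpoint a → ∀ i → i ℕ.≤ gap a → ∀ m →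
                partialSum (i ℕ.+ a) m ≡ ι i * recip (ι (gap a)) + partialSum a m
    sum-block {a} p zero    _     m = sym (trans
      (cong (_+ S) (trans (cong (_* r) ι-zero) (*-zeroˡ r))) (+-identityˡ S))
      where
      S : ℚ
      S = partialSum a m
      r : ℚ
      r = recip (ι (gap a))
    sum-block {a} p (suc i) i<gap m = begin
      S′ + recip (+ bound (i ℕ.+ a) / 1) ≡⟨ cong (λ z → S′ + recip z) (ι-unfold (bound (i ℕ.+ a))) ⟩
      S′ + recip (ι (bound (i ℕ.+ a)))
          ≡⟨ cong₂ _+_ (sum-block p i (ℕₚ.<⇒≤ i<gap) m) (cong (λ s → recip (ι (gap s))) within) ⟩
      ι i * r + S + r                   ≡⟨ +-comm (ι i * r + S) r ⟩
      r + (ι i * r + S)                 ≡⟨ +-assoc r (ι i * r) S ⟨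
      r + ι i * r + S                   ≡⟨ cong (_+ S) (ι-suc-* i r) ⟨
      ι (suc i) * r + S                 ∎
      where
      open ≡-Reasoning
      S : ℚ
      S = partialSum a m
      S′ : ℚ
      S′ = partialSum (i ℕ.+ a) m
      r : ℚ
      r = recip (ι (gap a))
      within : start (i ℕ.+ a) ≡ a
      within = trans (cong start (ℕₚ.+-comm i a)) (start-within i p i<gap)

  sum-gap : ∀ {a k} → Breakpoint a → (∀ m → partialSum a m ≡ ι k) →
            ∀ m → partialSum (gap a ℕ.+ a) m ≡ ι (suc k)
  sum-gap {a} {k} p S≡k m = begin
    partialSum (gap a ℕ.+ a) m                    ≡⟨ sum-block p (gap a) ℕₚ.≤-refl m ⟩
    ι (gap a) * recip (ι (gap a)) + partialSum a m ≡⟨ cong₂ _+_ (recip-*ˡ (ι (gap a)) 0<gap) (S≡k m) ⟩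
    1ℚ + ι k                                                      ≡⟨ ι-suc k ⟨
    ι (suc k)                                                     ∎
    where
    open ≡-Reasoning
    0<gap : 0ℚ < ι (gap a)
    0<gap = <-≤-trans (subst (_< ι 1) ι-zero (<ι-suc 0)) (ι-mono (ℕₚ.<⇒≤ (2≤gap a)))

  record Reaches (k : ℕ) : Set where
    field
      {end}   : ℕ
      break   : Breakpoint end
      sum≡    : ∀ m → partialSum end m ≡ ι k
  open Reaches

  -- At breakpoints the partial sums are exactly natural numbers, so divergence requires no
  -- estimates.
  reaches : ∀ k → Reaches k
  reaches zero    = record { break = start-zero ; sum≡ = λ m → trans (partialSum-zero m) (sym ι-zero) }
  reaches (suc k) = record
    { break = subst Breakpoint (ℕₚ.+-comm (end r) (gap (end r))) (next-breakpoint (break r))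
    ; sum≡  = sum-gap (break r) (sum≡ r)
    }
    where r = reaches k

  bound-slowGrowing : SlowGrowing boundℝ 1<bound
  bound-slowGrowing B = end r , proj₂ (below-fromℕ B) (sumBelow reciprocals (end r))
    (λ m → ≤-reflexive (trans (sym (sum≡ r m)) (sym (partialSum-unfold (end r) m))))
    where r = reaches (proj₁ (below-fromℕ B))

  ×ℝ-seq : ∀ L x n → seq (L ×ℝ x) n ≡ ι L * seq x n
  ×ℝ-seq zero    x n = sym (trans (cong (_* seq x n) ι-zero) (*-zeroˡ (seq x n)))
  ×ℝ-seq (suc L) x n = trans (cong (_+_ (seq x n)) (×ℝ-seq L x n)) (sym (ι-suc-* L (seq x n)))

  opaque
    -- Removes reals from the definition of shift complexity: `D` is at least the reciprocal of a
    -- positive rational that is eventually below δ, and `suc` absorbs the tolerance 1 used in the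
    -- real inequality.
    linear-bound : ∀ {δ} → constant 0ℚ <ℝ δ → ∃[ D ]
      (∀ L c k → (L ×ℝ δ) -ℝ fromℕ c ≤ℝ fromℕ k → L ℕ.≤ D ℕ.* suc (k ℕ.+ c))
    linear-bound {δ} (ε , 0<ε , M , ε≤δ) with D , 1≤Dε ← archimedean⁻¹ ε 0<ε = D , λ L c k lower →
      let N , p = lower 1ℚ (positive⁻¹ 1ℚ) in go L c k (M ℕ.⊔ N) (ε≤δ (M ℕ.⊔ N) (ℕₚ.m≤m⊔n M N))
          (subst₂ (λ p q → seq (L ×ℝ δ) (M ℕ.⊔ N) + - p ≤ q + 1ℚ)
            (ι-unfold c) (ι-unfold k) (p (M ℕ.⊔ N) (ℕₚ.m≤n⊔m M N)))
      where
      go : ∀ L c k n → 0ℚ + ε ≤ seq δ n → seq (L ×ℝ δ) n + - ι c ≤ ι k + 1ℚ → L ℕ.≤ D ℕ.* suc (k ℕ.+ c)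
      go L c k n ε≤δₙ p = ι-cancel L (D ℕ.* suc (k ℕ.+ c)) (begin
        ι L                               ≡⟨ *-identityʳ (ι L) ⟨
        ι L * 1ℚ                          ≤⟨ *-monoˡ-≤-nonNeg (ι L) 1≤Dε ⟩
        ι L * (ι D * ε)                   ≡⟨ rearrange (ι L) (ι D) ε ⟩
        ι D * (ι L * (0ℚ + ε))            ≤⟨ *-monoˡ-≤-nonNeg (ι D) (*-monoˡ-≤-nonNeg (ι L) ε≤δₙ) ⟩
        ι D * (ι L * seq δ n)             ≡⟨ cong (_*_ (ι D)) (×ℝ-seq L δ n) ⟨
        ι D * seq (L ×ℝ δ) n              ≡⟨ cong (_*_ (ι D)) (cancel (seq (L ×ℝ δ) n) (ι c)) ⟩
        ι D * (seq (L ×ℝ δ) n + - ι c + ι c) ≤⟨ *-monoˡ-≤-nonNeg (ι D) (+-monoˡ-≤ (ι c) p) ⟩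
        ι D * (ι k + 1ℚ + ι c)            ≡⟨ cong (λ z → ι D * (z + ι c)) (ι-+1 k) ⟩
        ι D * (ι (suc k) + ι c)           ≡⟨ cong (_*_ (ι D)) (ι-+ (suc k) c) ⟨
        ι D * ι (suc (k ℕ.+ c))           ≡⟨ ι-* D (suc (k ℕ.+ c)) ⟨
        ι (D ℕ.* suc (k ℕ.+ c))           ∎)
        where
        open ≤-Reasoning
        open +-*-Solver
        instance
          ι-nonNeg : ∀ {k} → NonNegative (ι k)
          ι-nonNeg {k} = nonNegative (0≤ι k)
        rearrange : ∀ l d e → l * (d * e) ≡ d * (l * (0ℚ + e))
        rearrange = solve 3 (λ l d e → l :* (d :* e) := d :* (l :* (con 0ℚ :+ e))) refl
        cancel : ∀ s c → s ≡ s + - c + c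
        cancel = solve 2 (λ s c → s := s :+ :- c :+ c) refl

-- Compressing initial segments computed from the generic sequence

module Main where

  open import Data.Nat
  open import Data.Nat.Properties
  open Recursive
  open Pairing
  open Bound
  open Genericity
  open Machines
  open Enumeration
  open Rationals

  module _ (em : ExcludedMiddle 0ℓ) {U : PR 1} (universal : Universal U) where
    open Forcing em
    open Generic (linear universal) task

    opaque
      generic∈LUAslow : LUAslow generic
      generic∈LUAslow = boundℝ , 1<bound , bound-isOrder , bound-slowGrowing ,
        (λ n → fromℕ-< (generic-bounded n)) , linear universal , linear-universal universal , generic-avoids

    opaque
      generic-guessed : ∀ {e} d Z → (∀ n → (λ (_ : ⊤) → generic) ⊢ e · (n ∷ []) ⇓ Z n) →
                        (∀ a → Z (point a) < colours a) → Guessed e d Z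
      generic-guessed {e} d Z = subst (λ (e , d) → Forced e d generic) (proj₂ (task-surjective e d))
        (generic-forced (proj₁ (task-surjective e d))) Z

      encode<colours : ∀ (X : ℕ → Bit) a → encode (substring X 0 (point a)) < colours a
      encode<colours X a = subst (encode σ <_)
        (trans (cong (λ l → 2 ^ suc l) (length-applyUpTo X (point a))) (colours-unfold a))
        (≤-trans (≤-trans (n≤1+n (suc (encode σ))) (≤-reflexive (+-comm 2 (encode σ)))) (encode-bound σ))
        where
        σ : String
        σ = substring X 0 (point a)

    short-program : ∀ {θ ρ} → Simulates U ρ θ →
                    ∀ {j σ l} → θ · (j ∷ []) ⇓ encode σ → j ≤ l → ∃[ k ] (K[ U ] σ ≡ k × k ≤ suc (length ρ) + l)
    short-program {ρ = ρ} sim {j} {σ} {l} p j≤l = k , proj₁ (proj₂ least) , (begin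
      k                           ≤⟨ proj₂ (proj₂ least) ⟩
      length (ρ ⌢ unary j)        ≡⟨ length-++ ρ ⟩
      length ρ + length (unary j) ≡⟨ cong (length ρ +_) (length-unary j) ⟩
      length ρ + suc j            ≡⟨ +-suc (length ρ) j ⟩
      suc (length ρ) + j          ≤⟨ +-monoʳ-≤ (suc (length ρ)) j≤l ⟩
      suc (length ρ) + l          ∎)
      where
      open ≤-Reasoning
      least = least-program em {U} {σ} (ρ ⌢ unary j) (Equivalence.from (sim j (encode σ)) p)
      k = proj₁ least

    opaque
      -- The constant `r` comes before `d`: it depends only on the prefix by which `U` simulates the
      -- guessing program, so `a` can afterwards be taken beyond it.
      compressible : ∀ {e} (X : ℕ → Bit) → (∀ i → (λ (_ : ⊤) → generic) ⊢ e · (i ∷ []) ⇓ toℕ (X i)) →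
                     ∃[ r ] ∀ d → ∃[ a ] (d ≤ a × ∃[ k ] (K[ U ] substring X 0 (point a) ≡ k × k ≤ r + maxInput a))
      compressible {e} X computes = suc (length (proj₁ sim)) , λ d → shorten (generic-guessed d
          (λ n → encode (substring X 0 n)) (initialCode-computes X computes) (encode<colours X))
        where
        sim : ∃[ ρ ] Simulates U ρ (guess (initialCode e))
        sim = simulate universal (guess (initialCode e))
        shorten : ∀ {d} → Guessed (initialCode e) d (λ n → encode (substring X 0 n)) →
                  ∃[ a ] (d ≤ a ×
                    ∃[ k ] (K[ U ] substring X 0 (point a) ≡ k × k ≤ suc (length (proj₁ sim)) + maxInput a))
        shorten (a , d≤a , j , j≤ , p) =
          a , d≤a , short-program {ρ = proj₁ sim} (proj₂ sim) {σ = substring X 0 (point a)} p j≤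

    not-shiftComplex : ∀ {e} (X : ℕ → Bit) → (∀ i → (λ (_ : ⊤) → generic) ⊢ e · (i ∷ []) ⇓ toℕ (X i)) →
                       ¬ ShiftComplex U X
    not-shiftComplex X computes (δ , 0<δ , _ , c , complex) = <⇒≱ (<point a) (begin
      point a                              ≤⟨ point≤ ⟩
      D * suc (k + c)                      ≤⟨ *-mono-≤ D≤a (begin
        suc (k + c)                          ≡⟨ +-suc k c ⟨
        k + suc c                            ≤⟨ +-monoˡ-≤ (suc c) k≤ ⟩
        r + maxInput a + suc c               ≡⟨ +-comm (r + maxInput a) (suc c) ⟩
        suc c + (r + maxInput a)             ≡⟨ +-assoc (suc c) r (maxInput a) ⟨
        suc c + r + maxInput a               ≤⟨ +-monoˡ-≤ (maxInput a) (m+n≤o⇒n≤o D d≤a) ⟩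
        a + maxInput a                       ∎) ⟩
      a * (a + maxInput a)                 ∎)
      where
      open ≤-Reasoning
      D : ℕ
      D = proj₁ (linear-bound 0<δ)
      r : ℕ
      r = proj₁ (compressible X computes)
      -- With this threshold `a` dominates both the factor `D` and the sum of all additive
      -- constants.
      found : ∃[ a ] (D + (suc c + r) ≤ a × ∃[ k ] (K[ U ] substring X 0 (point a) ≡ k × k ≤ r + maxInput a))
      found = proj₂ (compressible X computes) (D + (suc c + r))
      a : ℕ
      a = proj₁ found
      d≤a : D + (suc c + r) ≤ a
      d≤a = proj₁ (proj₂ found)
      D≤a : D ≤ a
      D≤a = m+n≤o⇒m≤o D d≤a
      k : ℕ
      k = proj₁ (proj₂ (proj₂ found))
      k≤ : k ≤ r + maxInput a
      k≤ = proj₂ (proj₂ (proj₂ (proj₂ found)))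
      point≤ : point a ≤ D * suc (k + c)
      point≤ = subst (_≤ D * suc (k + c)) (length-applyUpTo X (point a))
        (proj₂ (linear-bound 0<δ) (length (substring X 0 (point a))) c k
          (complex 0 (point a) k (proj₁ (proj₂ (proj₂ (proj₂ found))))))

open Main

mainTheorem9 : ExcludedMiddle 0ℓ →
    (U : PR 1) → Universal U → ¬ (SC U ≤w LUAslow)
mainTheorem9 em U universal reduction
  with X , (B , X≡B , complex) , e , computes ← reduction _ (generic∈LUAslow em universal) =
  not-shiftComplex em universal B (λ i → subst (_ ⊢ e · (i ∷ []) ⇓_) (X≡B i) (computes i)) complex
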